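{- For every real $\alpha$ with $0<\alpha<1$ there exists a constant $C=C(\alpha)>0$ such that for every function $p=p(n)$ with $C/n\le p\le 1$, with high probability $\alpha n$ cops do not suffice to catch the robber on the random graph $G_{n,p}$; that is, $\Pr[\mathrm{ent}(G_{n,p})>\alpha n]\to 1$ as $n\to\infty$. The same result holds for directed random graphs: for every $0<\alpha<1$ there is a constant $C>0$ such that for every $p=p(n)$ with $C/n\le p\le 1$, with high probability $\alpha n$ cops do not suffice to catch the robber on the directed random graph on $n$ vertices with arc probability $p$.
   Context: Entanglement game on a finite (directed or undirected) graph $G$ with $k$ cops: First the robber chooses a starting vertex, and all $k$ cops are outside the graph. In every turn, the cops either all stay where they are, or exactly one of them flies (from wherever it is, on or off the graph) to the current position of the robber. Regardless of which of these happened, the robber then has to move to a neighbor of his current position (in a directed graph: a successor, i.e. an out-neighbor) that is not occupied by a cop. If there is no such neighbor, the cops win. The robber wins if he can run away indefinitely. Both sides have full information. The entanglement number $\mathrm{ent}(G)$ is the minimal integer $k$ such that $k$ cops have a strategy to catch the robber on $G$. "$\alpha n$ cops do not suffice" means that no integer number $k\le\alpha n$ of cops can catch the robber, i.e. $\mathrm{ent}(G)>\alpha n$. $G_{n,p}$ is the Erdős–Rényi random graph on $n$ vertices in which each unordered pair of distinct vertices is an edge independently with probability $p$. In the directed random graph each ordered pair $(u,v)$ of distinct vertices is an arc independently with probability $p$. "With high probability" means with probability tending to $1$ as $n\to\infty$. -}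

module Defs where

open import Data.Bool.Base using (Bool; T; if_then_else_)
open import Data.Fin.Base as Fin using (Fin)
open import Data.Fin.Properties as Fin using ()
open import Data.Fin.Subset using (Subset; inside; outside; _∈_)
open import Data.Integer.Base as ℤ using ()
open import Data.List.Base as List
  using (List; []; _∷_; _++_; map; foldr; length; lookup; filter; filterᵇ; allFin; cartesianProduct)
open import Data.Maybe.Base using (Maybe; just; nothing)
open import Data.Nat.Base as ℕ using (ℕ; zero; suc)
open import Data.Nat.Properties as ℕ using ()
open import Data.Product.Base using (∃; ∃-syntax; _×_; _,_; proj₁; proj₂)
open import Data.Rational.Base as ℚ using (ℚ; 0ℚ; 1ℚ; ½)
open import Data.Rational.Properties as ℚ using ()
open import Data.Rational.Solver using (module +-*-Solver)
open import Data.Sum.Base using (_⊎_)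
open import Data.Vec.Base as Vec using ([]; _∷_)
open import Data.Vec.Functional using (Vector; updateAt)
open import Level using (0ℓ)
open import Relation.Binary.Core using (Rel)
open import Relation.Binary.PropositionalEquality
open import Relation.Nullary using (¬_; ¬?)
open import Relation.Unary using (Pred)

------------------------------------------------------------------------
-- Real numbers as Cauchy sequences of rationals.  Since ∃ is a Σ-type,
-- every real carries a modulus of convergence.  Sequences are not
-- quotiented: the order relations below respect equality of limits.

IsCauchy : (ℕ → ℚ) → Set
IsCauchy x = ∀ ε → 0ℚ ℚ.< ε →
  ∃[ N ] ∀ m n → N ℕ.≤ m → N ℕ.≤ n → ℚ.∣ x m ℚ.- x n ∣ ℚ.≤ ε

record ℝ : Set where
  constructor mkℝ
  field
    seq    : ℕ → ℚ
    cauchy : IsCauchy seq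

open ℝ public

infix  4 _<_ _≤_
infixl 6 _+_ _-_
infixl 7 _*_

_<_ : Rel ℝ 0ℓ
x < y = ∃[ ε ] 0ℚ ℚ.< ε × ∃[ N ] ∀ n → N ℕ.≤ n → seq x n ℚ.+ ε ℚ.≤ seq y n

_≤_ : Rel ℝ 0ℓ
x ≤ y = ∀ ε → 0ℚ ℚ.< ε → ∃[ N ] ∀ n → N ℕ.≤ n → seq x n ℚ.≤ seq y n ℚ.+ ε

fromℚ : ℚ → ℝ
fromℚ q = mkℝ (λ _ → q) λ ε 0<ε → 0 , λ _ _ _ _ →
  subst (ℚ._≤ ε) (sym (cong ℚ.∣_∣ (ℚ.+-inverseʳ q))) (ℚ.<⇒≤ 0<ε)

fromℕ : ℕ → ℝ
fromℕ n = fromℚ (ℤ.+ n ℚ./ 1)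

0ℝ 1ℝ : ℝ
0ℝ = fromℚ 0ℚ
1ℝ = fromℚ 1ℚ

private
  half-pos : ∀ {ε} → 0ℚ ℚ.< ε → 0ℚ ℚ.< ½ ℚ.* ε
  half-pos {ε} 0<ε = subst (ℚ._< ½ ℚ.* ε) (ℚ.*-zeroʳ ½) (ℚ.*-monoʳ-<-pos ½ 0<ε)

  halves : ∀ ε → ½ ℚ.* ε ℚ.+ ½ ℚ.* ε ≡ ε
  halves ε = trans (sym (ℚ.*-distribʳ-+ ε ½ ½)) (ℚ.*-identityˡ ε)

  +-cauchy : ∀ {x y} → IsCauchy x → IsCauchy y → IsCauchy (λ n → x n ℚ.+ y n)
  +-cauchy {x} {y} cx cy ε 0<ε
    with M , hx ← cx (½ ℚ.* ε) (half-pos 0<ε)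
       | N , hy ← cy (½ ℚ.* ε) (half-pos 0<ε)
    = M ℕ.⊔ N , λ m n lm ln → begin
      ℚ.∣ (x m ℚ.+ y m) ℚ.- (x n ℚ.+ y n) ∣
        ≡⟨ cong ℚ.∣_∣ (rearrange (x m) (y m) (x n) (y n)) ⟩
      ℚ.∣ (x m ℚ.- x n) ℚ.+ (y m ℚ.- y n) ∣
        ≤⟨ ℚ.∣p+q∣≤∣p∣+∣q∣ (x m ℚ.- x n) (y m ℚ.- y n) ⟩
      ℚ.∣ x m ℚ.- x n ∣ ℚ.+ ℚ.∣ y m ℚ.- y n ∣
        ≤⟨ ℚ.+-mono-≤ (hx m n (ℕ.m⊔n≤o⇒m≤o M N lm) (ℕ.m⊔n≤o⇒m≤o M N ln))
                      (hy m n (ℕ.m⊔n≤o⇒n≤o M N lm) (ℕ.m⊔n≤o⇒n≤o M N ln)) ⟩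
      ½ ℚ.* ε ℚ.+ ½ ℚ.* ε
        ≡⟨ halves ε ⟩
      ε ∎
    where
    open ℚ.≤-Reasoning
    rearrange : ∀ a b c d → (a ℚ.+ b) ℚ.- (c ℚ.+ d) ≡ (a ℚ.- c) ℚ.+ (b ℚ.- d)
    rearrange = solve 4 (λ a b c d →
      (a :+ b) :- (c :+ d) := (a :- c) :+ (b :- d)) refl
      where open +-*-Solver

  neg-cauchy : ∀ {x} → IsCauchy x → IsCauchy (λ n → ℚ.- x n)
  neg-cauchy {x} cx ε 0<ε with N , h ← cx ε 0<ε
    = N , λ m n lm ln → subst (ℚ._≤ ε) (sym (eq m n)) (h m n lm ln)
    where
    eq : ∀ m n → ℚ.∣ ℚ.- x m ℚ.- (ℚ.- x n) ∣ ≡ ℚ.∣ x m ℚ.- x n ∣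
    eq m n = trans (cong ℚ.∣_∣ (sym (ℚ.neg-distrib-+ (x m) (ℚ.- x n))))
                   (ℚ.∣-p∣≡∣p∣ (x m ℚ.- x n))

  bounded : ∀ {x} → IsCauchy x →
    ∃[ A ] 0ℚ ℚ.< A × ∃[ N ] ∀ n → N ℕ.≤ n → ℚ.∣ x n ∣ ℚ.≤ A
  bounded {x} cx with N , h ← cx 1ℚ (ℚ.positive⁻¹ 1ℚ)
    = 1ℚ ℚ.+ ℚ.∣ x N ∣
    , ℚ.+-mono-<-≤ (ℚ.positive⁻¹ 1ℚ) (ℚ.0≤∣p∣ (x N))
    , N , λ n ln → begin
      ℚ.∣ x n ∣                         ≡⟨ cong ℚ.∣_∣ (split (x n) (x N)) ⟩
      ℚ.∣ (x n ℚ.- x N) ℚ.+ x N ∣       ≤⟨ ℚ.∣p+q∣≤∣p∣+∣q∣ (x n ℚ.- x N) (x N) ⟩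
      ℚ.∣ x n ℚ.- x N ∣ ℚ.+ ℚ.∣ x N ∣   ≤⟨ ℚ.+-monoˡ-≤ ℚ.∣ x N ∣ (h n N ln ℕ.≤-refl) ⟩
      1ℚ ℚ.+ ℚ.∣ x N ∣                  ∎
    where
    open ℚ.≤-Reasoning
    split : ∀ a b → a ≡ (a ℚ.- b) ℚ.+ b
    split = solve 2 (λ a b → a := (a :- b) :+ b) refl
      where open +-*-Solver

  *-bound : ∀ {a b A B} → ℚ.∣ a ∣ ℚ.≤ A → ℚ.∣ b ∣ ℚ.≤ B → ℚ.∣ a ℚ.* b ∣ ℚ.≤ A ℚ.* B
  *-bound {a} {b} {A} {B} a≤A b≤B = begin
    ℚ.∣ a ℚ.* b ∣       ≡⟨ ℚ.∣p*q∣≡∣p∣*∣q∣ a b ⟩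
    ℚ.∣ a ∣ ℚ.* ℚ.∣ b ∣ ≤⟨ ℚ.*-monoʳ-≤-nonNeg ℚ.∣ b ∣ {{ℚ.∣-∣-nonNeg b}} a≤A ⟩
    A ℚ.* ℚ.∣ b ∣       ≤⟨ ℚ.*-monoˡ-≤-nonNeg A {{ℚ.nonNegative 0≤A}} b≤B ⟩
    A ℚ.* B             ∎
    where
    open ℚ.≤-Reasoning
    0≤A = ℚ.≤-trans (ℚ.0≤∣p∣ a) a≤A

  tolerance : ∀ A B ε → 0ℚ ℚ.< A → 0ℚ ℚ.< B → 0ℚ ℚ.< ε →
    ∃[ δ ] 0ℚ ℚ.< δ × A ℚ.* δ ℚ.+ δ ℚ.* B ≡ ε
  tolerance A B ε 0<A 0<B 0<ε = go (A ℚ.+ B) refl (ℚ.+-mono-< 0<A 0<B)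
    where
    go : ∀ S → A ℚ.+ B ≡ S → 0ℚ ℚ.< S → ∃[ δ ] 0ℚ ℚ.< δ × A ℚ.* δ ℚ.+ δ ℚ.* B ≡ ε
    go S A+B≡S 0<S = δ , 0<δ , eq
      where
      instance
        S-pos : ℚ.Positive S
        S-pos = ℚ.positive 0<S
        S-nonZero : ℚ.NonZero S
        S-nonZero = ℚ.pos⇒nonZero S
      r = ℚ.1/ S
      δ = r ℚ.* ε
      0<δ : 0ℚ ℚ.< δ
      0<δ = subst (ℚ._< δ) (ℚ.*-zeroʳ r) (ℚ.*-monoʳ-<-pos r {{ℚ.1/pos⇒pos S}} 0<ε)
      open ≡-Reasoning
      eq : A ℚ.* δ ℚ.+ δ ℚ.* B ≡ ε
      eq = begin
        A ℚ.* δ ℚ.+ δ ℚ.* B   ≡⟨ cong (A ℚ.* δ ℚ.+_) (ℚ.*-comm δ B) ⟩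
        A ℚ.* δ ℚ.+ B ℚ.* δ   ≡⟨ ℚ.*-distribʳ-+ δ A B ⟨
        (A ℚ.+ B) ℚ.* δ       ≡⟨ cong (ℚ._* δ) A+B≡S ⟩
        S ℚ.* (r ℚ.* ε)       ≡⟨ ℚ.*-assoc S r ε ⟨
        (S ℚ.* r) ℚ.* ε       ≡⟨ cong (ℚ._* ε) (ℚ.*-inverseʳ S) ⟩
        1ℚ ℚ.* ε              ≡⟨ ℚ.*-identityˡ ε ⟩
        ε                     ∎

  *-close : ∀ a b c d {A B δ} →
    ℚ.∣ a ∣ ℚ.≤ A → ℚ.∣ d ∣ ℚ.≤ B → ℚ.∣ a ℚ.- c ∣ ℚ.≤ δ → ℚ.∣ b ℚ.- d ∣ ℚ.≤ δ →
    ℚ.∣ a ℚ.* b ℚ.- c ℚ.* d ∣ ℚ.≤ A ℚ.* δ ℚ.+ δ ℚ.* B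
  *-close a b c d {A} {B} {δ} a≤A d≤B a-c b-d = begin
    ℚ.∣ a ℚ.* b ℚ.- c ℚ.* d ∣
      ≡⟨ cong ℚ.∣_∣ (rearrange a b c d) ⟩
    ℚ.∣ a ℚ.* (b ℚ.- d) ℚ.+ (a ℚ.- c) ℚ.* d ∣
      ≤⟨ ℚ.∣p+q∣≤∣p∣+∣q∣ (a ℚ.* (b ℚ.- d)) ((a ℚ.- c) ℚ.* d) ⟩
    ℚ.∣ a ℚ.* (b ℚ.- d) ∣ ℚ.+ ℚ.∣ (a ℚ.- c) ℚ.* d ∣
      ≤⟨ ℚ.+-mono-≤ (*-bound {a} {b ℚ.- d} a≤A b-d) (*-bound {a ℚ.- c} {d} a-c d≤B) ⟩
    A ℚ.* δ ℚ.+ δ ℚ.* B ∎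
    where
    open ℚ.≤-Reasoning
    rearrange : ∀ a b c d →
      a ℚ.* b ℚ.- c ℚ.* d ≡ a ℚ.* (b ℚ.- d) ℚ.+ (a ℚ.- c) ℚ.* d
    rearrange = solve 4 (λ a b c d →
      a :* b :- c :* d := a :* (b :- d) :+ (a :- c) :* d) refl
      where open +-*-Solver

  *-cauchy : ∀ {x y} → IsCauchy x → IsCauchy y → IsCauchy (λ n → x n ℚ.* y n)
  *-cauchy {x} {y} cx cy ε 0<ε =
    let A , 0<A , K , hA = bounded cx
        B , 0<B , L , hB = bounded cy
        δ , 0<δ , eq = tolerance A B ε 0<A 0<B 0<ε
        M , hx = cx δ 0<δ
        N , hy = cy δ 0<δ
    in (M ℕ.⊔ N) ℕ.⊔ (K ℕ.⊔ L) , λ m n lm ln →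
      let m₁ = ℕ.m⊔n≤o⇒m≤o (M ℕ.⊔ N) (K ℕ.⊔ L) lm
          m₂ = ℕ.m⊔n≤o⇒n≤o (M ℕ.⊔ N) (K ℕ.⊔ L) lm
          n₁ = ℕ.m⊔n≤o⇒m≤o (M ℕ.⊔ N) (K ℕ.⊔ L) ln
          n₂ = ℕ.m⊔n≤o⇒n≤o (M ℕ.⊔ N) (K ℕ.⊔ L) ln
      in subst (ℚ.∣ x m ℚ.* y m ℚ.- x n ℚ.* y n ∣ ℚ.≤_) eq
           (*-close (x m) (y m) (x n) (y n)
             (hA m (ℕ.m⊔n≤o⇒m≤o K L m₂))
             (hB n (ℕ.m⊔n≤o⇒n≤o K L n₂))
             (hx m n (ℕ.m⊔n≤o⇒m≤o M N m₁) (ℕ.m⊔n≤o⇒m≤o M N n₁))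
             (hy m n (ℕ.m⊔n≤o⇒n≤o M N m₁) (ℕ.m⊔n≤o⇒n≤o M N n₁)))

_+_ : ℝ → ℝ → ℝ
x + y = mkℝ (λ n → seq x n ℚ.+ seq y n) (+-cauchy {seq x} {seq y} (cauchy x) (cauchy y))

-_ : ℝ → ℝ
- x = mkℝ (λ n → ℚ.- seq x n) (neg-cauchy {seq x} (cauchy x))

_-_ : ℝ → ℝ → ℝ
x - y = x + (- y)

_*_ : ℝ → ℝ → ℝ
x * y = mkℝ (λ n → seq x n ℚ.* seq y n) (*-cauchy {seq x} {seq y} (cauchy x) (cauchy y))

module Game {n : ℕ} (E : Rel (Fin n) 0ℓ) where

  -- `nothing` stands for a cop outside the graph.
  Cops : ℕ → Set
  Cops k = Vector (Maybe (Fin n)) k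

  Occupied : ∀ {k} → Cops k → Fin n → Set
  Occupied c v = ∃[ i ] c i ≡ just v

  data CopMove {k} (c : Cops k) (r : Fin n) : Cops k → Set where
    stay : CopMove c r c
    fly  : ∀ i → CopMove c r (updateAt c i (λ _ → just r))

  -- The cops are to move and the robber is at r.  An element is a
  -- well-founded strategy tree, so no play consistent with it is infinite;
  -- its leaves are the positions from which the robber cannot move.
  data CopsWin {k} (c : Cops k) (r : Fin n) : Set where
    turn : ∀ {c′} → CopMove c r c′ →
           (∀ v → E r v → ¬ Occupied c′ v → CopsWin c′ v) →
           CopsWin c r

  CopsCatch : ℕ → Set
  CopsCatch k = ∀ r → CopsWin {k} (λ _ → nothing) r

open Game public using (CopsCatch)

-- "x cops do not suffice", i.e. ent > x.
DoNotSuffice : ∀ {n} → Rel (Fin n) 0ℓ → ℝ → Set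
DoNotSuffice E x = ∀ k → fromℕ k ≤ x → ¬ CopsCatch E k

------------------------------------------------------------------------
-- Random subsets: each of m elements is chosen independently with
-- probability p.

subsets : ∀ m → List (Subset m)
subsets zero    = [] ∷ []
subsets (suc m) = map (inside ∷_) (subsets m) ++ map (outside ∷_) (subsets m)

weight : ℝ → ∀ {m} → Subset m → ℝ
weight p = Vec.foldr (λ _ → ℝ) (λ b w → (if b then p else 1ℝ - p) * w) 1ℝ

Pr : ℝ → ∀ {m} → (Subset m → Bool) → ℝ
Pr p {m} B = foldr (λ S s → weight p S + s) 0ℝ (filterᵇ B (subsets m))

-- An event about real parameters need not be decidable, hence need not have
-- an indicator function.  Its probability exceeds q iff that of some
-- decidable event contained in it does.
Pr[_]_>_ : ℝ → ∀ {m} → Pred (Subset m) 0ℓ → ℝ → Set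
Pr[ p ] A > q = ∃[ B ] (∀ S → T (B S) → A S) × q < Pr p B

WithHighProbability : (p : ℕ → ℝ) {m : ℕ → ℕ} → (∀ n → Pred (Subset (m n)) 0ℓ) → Set
WithHighProbability p A =
  ∀ ε → 0ℝ < ε → ∃[ N ] ∀ n → N ℕ.≤ n → Pr[ p n ] A n > (1ℝ - ε)

------------------------------------------------------------------------
-- Random graphs on Fin n: an outcome is the set of pairs that are present.

orderedPairs : ∀ n → List (Fin n × Fin n)
orderedPairs n =
  filter (λ e → ¬? (proj₁ e Fin.≟ proj₂ e)) (cartesianProduct (allFin n) (allFin n))

-- The unordered pair {u , v} is represented by (u , v) with u < v.
unorderedPairs : ∀ n → List (Fin n × Fin n)
unorderedPairs n =
  filter (λ e → proj₁ e Fin.<? proj₂ e) (cartesianProduct (allFin n) (allFin n))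

Graph : ℕ → Set
Graph n = Subset (length (unorderedPairs n))

Digraph : ℕ → Set
Digraph n = Subset (length (orderedPairs n))

Adj : ∀ n → Graph n → Rel (Fin n) 0ℓ
Adj n G u v = ∃[ e ] e ∈ G ×
  (lookup (unorderedPairs n) e ≡ (u , v) ⊎ lookup (unorderedPairs n) e ≡ (v , u))

Arc : ∀ n → Digraph n → Rel (Fin n) 0ℓ
Arc n G u v = ∃[ e ] e ∈ G × lookup (orderedPairs n) e ≡ (u , v)

-- C/n ≤ p(n) ≤ 1 for all sufficiently large n.  For n < C no value of p(n)
-- would do, so the condition cannot be imposed on every n.
Admissible : ℝ → (ℕ → ℝ) → Set
Admissible C p = ∃[ n₀ ] ∀ n → .{{_ : ℕ.NonZero n}} → n₀ ℕ.≤ n →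
  C * fromℚ (ℤ.+ 1 ℚ./ n) ≤ p n × p n ≤ 1ℝ

{-# OPTIONS --safe #-}

-- Call a digraph on n vertices m-expanding if any two disjoint sets of at
-- least m vertices have an arc from the first to the second.  On such a graph
-- the robber escapes k cops as soon as k + 3m ≤ n.  Let F, of size at least
-- 3m, be the set of cop-free vertices, and call a vertex trapped if fewer than
-- m vertices are reachable from it inside F.  By expansion no set closed under
-- arcs inside F has between m and |F| - m vertices, so a union of small closed
-- sets is small again.  If all moves of the robber led to trapped vertices,
-- then the union of the sets reachable from them, together with the robber's
-- position, would be a small closed set; hence an untrapped robber can stay
-- untrapped.  If all vertices were trapped initially, the whole vertex set
-- would be small.
--
-- For m = ⌊n / 3d⌋ with 1/d ≤ (1 - α)/2 and p ≥ C/n, a fixed pair of sets of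
-- size at least m has no arc with probability at most (1 - p)^(m²).  By
-- Bernoulli's inequality (1 - p)^m ≤ 1/(1 + mp) ≤ 8^(-6d) if C is large, and
-- n ≤ 6dm, so this is at most 8^(-n).  There are at most 4^n pairs of sets.

module Submission where

open import Defs
open import Algebra.Bundles using (CommutativeRing)
open import Data.Bool.Base using (Bool; true; false; T; if_then_else_; _∧_; _∨_; not)
open import Data.Bool.ListAction using (all)
open import Data.Fin.Base as Fin using (Fin)
open import Data.Fin.Properties as Fin using ()
open import Data.Fin.Subset using (Subset; inside; outside; _∈_; _∉_; _⊆_; _∪_; _∩_; ∁; ⊥; ⊤; ⁅_⁆; ∣_∣)
open import Data.Fin.Subset.Properties
open import Data.Integer.Base as ℤ using (+_)
open import Data.Integer.Properties as ℤ using ()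
open import Data.List.Base as List
  using (List; []; _∷_; _++_; map; foldr; length; filter; filterᵇ; allFin; cartesianProduct)
open import Data.List.Properties as List using ()
open import Data.List.Membership.Propositional as List using ()
open import Data.List.Membership.Propositional.Properties as List using ()
open import Data.List.Relation.Unary.All as All using (All; []; _∷_)
open import Data.List.Relation.Unary.All.Properties as All using ()
open import Data.List.Relation.Unary.Any using (here; there)
open import Data.Maybe.Base using (just; nothing; maybe′)
open import Data.Maybe.Properties using (just-injective)
open import Data.Nat.Base as ℕ using (ℕ; zero; suc; z≤n; s≤s)
open import Data.Nat.DivMod as ℕ using ()
open import Data.Nat.ListAction using (sum)
open import Data.Nat.Properties as ℕ using ()
open import Data.Nat.Solver using () renaming (module +-*-Solver to ℕ-Solver)
open import Data.Product.Base using (∃-syntax; ∃₂; _×_; _,_; proj₁; proj₂)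
open import Data.Product.Properties using (≡-dec)
open import Data.Rational.Base as ℚ using (ℚ; mkℚ; 0ℚ; 1ℚ; ½)
open import Data.Rational.Properties as ℚ using ()
open import Data.Rational.Solver using () renaming (module +-*-Solver to ℚ-Solver)
open import Data.Rational.Unnormalised.Base as ℚᵘ using (mkℚᵘ; *≡*)
open import Data.Rational.Unnormalised.Properties as ℚᵘ using ()
open import Data.Sum.Base using (_⊎_; inj₁; inj₂)
open import Data.Unit.Base using (tt) renaming (⊤ to Unit)
open import Data.Vec.Base as Vec using ([]; _∷_)
open import Data.Vec.Functional.Properties using (updateAt-updates; updateAt-minimal)
open import Data.Vec.Properties as Vec using ()
open import Function.Base using (_∘′_; id)
open import Level using (0ℓ)
open import Relation.Binary.Core using (Rel)
open import Relation.Binary.Definitions using (Decidable; tri<; tri≈; tri>)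
open import Relation.Binary.PropositionalEquality
open import Relation.Nullary using (¬_; Dec; yes; no; contradiction; does)
open import Relation.Nullary.Decidable using (_×-dec_; _⊎-dec_; dec-true)
open import Relation.Unary as Unary using (Pred)
open import Algebra.Properties.CommutativeSemiring.Exp
  (CommutativeRing.commutativeSemiring ℚ.+-*-commutativeRing)
  using (_^_; ^-assocʳ; ^-distrib-*)

-- Cardinalities of subsets, and the expansion property.

∣p∪q∣≤∣p∣+∣q∣ : ∀ {n} (p q : Subset n) → ∣ p ∪ q ∣ ℕ.≤ ∣ p ∣ ℕ.+ ∣ q ∣
∣p∪q∣≤∣p∣+∣q∣ []            []            = z≤n
∣p∪q∣≤∣p∣+∣q∣ (inside  ∷ p) (y ∷ q)       =
  s≤s (ℕ.≤-trans (∣p∪q∣≤∣p∣+∣q∣ p q) (ℕ.+-monoʳ-≤ ∣ p ∣ (∣p∣≤∣x∷p∣ y q)))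
∣p∪q∣≤∣p∣+∣q∣ (outside ∷ p) (inside  ∷ q) =
  subst (suc ∣ p ∪ q ∣ ℕ.≤_) (sym (ℕ.+-suc ∣ p ∣ ∣ q ∣)) (s≤s (∣p∪q∣≤∣p∣+∣q∣ p q))
∣p∪q∣≤∣p∣+∣q∣ (outside ∷ p) (outside ∷ q) = ∣p∪q∣≤∣p∣+∣q∣ p q

∣p∣≤∣p∩∁q∣+∣q∣ : ∀ {n} (p q : Subset n) → ∣ p ∣ ℕ.≤ ∣ p ∩ ∁ q ∣ ℕ.+ ∣ q ∣
∣p∣≤∣p∩∁q∣+∣q∣ p q = ℕ.≤-trans (p⊆q⇒∣p∣≤∣q∣ p⊆) (∣p∪q∣≤∣p∣+∣q∣ (p ∩ ∁ q) q)
  where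
  p⊆ : p ⊆ (p ∩ ∁ q) ∪ q
  p⊆ {x} x∈p with x ∈? q
  ... | yes x∈q = x∈p∪q⁺ {p = p ∩ ∁ q} (inj₂ x∈q)
  ... | no  x∉q = x∈p∪q⁺ {q = q} (inj₁ (x∈p∩q⁺ (x∈p , x∉p⇒x∈∁p x∉q)))

Expands : ∀ {n} → Rel (Fin n) 0ℓ → ℕ → Set
Expands E m = ∀ A B → (∀ {x} → x ∈ A → x ∉ B) → m ℕ.≤ ∣ A ∣ → m ℕ.≤ ∣ B ∣ →
  ∃₂ λ u v → u ∈ A × v ∈ B × E u v

-- The robber's escape on an expanding digraph.

module Robber {n} (E : Rel (Fin n) 0ℓ) (E? : Decidable E) {m} (expands : Expands E (suc m)) where

  open Game E hiding (CopsCatch)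

  Closed : Subset n → Subset n → Set
  Closed F A = ∀ {u v} → u ∈ A → v ∈ F → E u v → v ∈ A

  -- The trapped vertices. Any set containing `r` and closed under arcs into `F` contains everything
  -- reachable from `r` inside `F`, so bounding one such set replaces computing reachability. The
  -- expansion parameter is `suc m`, hence "fewer than `suc m`" reads `≤ m`.
  Small : Subset n → Fin n → Set
  Small F r = ∃[ A ] Closed F A × ∣ A ∣ ℕ.≤ m × r ∈ A

  -- No arc leaves a closed set, so by expansion its size is either at most m
  -- or nearly that of F.
  gap : ∀ {F A} → 3 ℕ.* suc m ℕ.≤ ∣ F ∣ → Closed F A → ∣ A ∣ ℕ.≤ 2 ℕ.* suc m → ∣ A ∣ ℕ.≤ m
  gap {F} {A} 3m≤F closed A≤2m with ∣ A ∣ ℕ.≤? m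
  ... | yes A≤m = A≤m
  ... | no  A≰m =
    let u , v , u∈A , v∈ , Euv = expands A (F ∩ ∁ A)
          (λ x∈A x∈ → x∈∁p⇒x∉p (proj₂ (x∈p∩q⁻ F (∁ A) x∈)) x∈A) (ℕ.≰⇒> A≰m) large
        v∈F , v∈∁A = x∈p∩q⁻ F (∁ A) v∈
    in contradiction (closed u∈A v∈F Euv) (x∈∁p⇒x∉p v∈∁A)
    where
    large : suc m ℕ.≤ ∣ F ∩ ∁ A ∣
    large = ℕ.+-cancelʳ-≤ (2 ℕ.* suc m) (suc m) ∣ F ∩ ∁ A ∣ (begin
      suc m ℕ.+ 2 ℕ.* suc m        ≤⟨ 3m≤F ⟩
      ∣ F ∣                        ≤⟨ ∣p∣≤∣p∩∁q∣+∣q∣ F A ⟩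
      ∣ F ∩ ∁ A ∣ ℕ.+ ∣ A ∣          ≤⟨ ℕ.+-monoʳ-≤ ∣ F ∩ ∁ A ∣ A≤2m ⟩
      ∣ F ∩ ∁ A ∣ ℕ.+ 2 ℕ.* suc m    ∎)
      where open ℕ.≤-Reasoning

  closed-∪ : ∀ {F A B} → Closed F A → Closed F B → Closed F (A ∪ B)
  closed-∪ {F} {A} {B} cA cB u∈ v∈F Euv with x∈p∪q⁻ A B u∈
  ... | inj₁ u∈A = x∈p∪q⁺ {q = B} (inj₁ (cA u∈A v∈F Euv))
  ... | inj₂ u∈B = x∈p∪q⁺ {p = A} (inj₂ (cB u∈B v∈F Euv))

  -- Small closed sets are merged one at a time, and `gap` is applied after every merge: a closed
  -- union of two sets of size at most `m` has size at most `2 * suc m`, hence at most `m` again.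
  -- The bound therefore does not grow with the number of vertices covered.
  cover : ∀ {F} {Q : Fin n → Set} → (∀ v → Dec (Q v)) → 3 ℕ.* suc m ℕ.≤ ∣ F ∣ →
    (∀ v → Q v → Small F v) →
    ∃[ U ] Closed F U × ∣ U ∣ ℕ.≤ m × (∀ v → Q v → v ∈ U)
  cover {F} {Q} Q? 3m≤F small =
    let U , cU , U≤m , U∋ = go (allFin n) in
    U , cU , U≤m , λ v → U∋ v (List.∈-allFin v)
    where
    go : ∀ vs → ∃[ U ] Closed F U × ∣ U ∣ ℕ.≤ m × (∀ v → v List.∈ vs → Q v → v ∈ U)
    go [] = ⊥ , (λ u∈⊥ → contradiction u∈⊥ ∉⊥) , subst (ℕ._≤ m) (sym (∣⊥∣≡0 n)) z≤n , λ _ ()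
    go (w ∷ vs) with U , cU , U≤m , U∋ ← go vs | Q? w
    ... | no ¬Qw = U , cU , U≤m , λ where
      v (here refl) Qv → contradiction Qv ¬Qw
      v (there v∈)  Qv → U∋ v v∈ Qv
    ... | yes Qw with A , cA , A≤m , w∈A ← small w Qw
      = A ∪ U , closed-∪ {A = A} cA cU , gap 3m≤F (closed-∪ {A = A} cA cU) A∪U≤2m , λ where
        v (here refl) Qv → x∈p∪q⁺ {q = U} (inj₁ w∈A)
        v (there v∈)  Qv → x∈p∪q⁺ {p = A} (inj₂ (U∋ v v∈ Qv))
      where
      A∪U≤2m : ∣ A ∪ U ∣ ℕ.≤ 2 ℕ.* suc m
      A∪U≤2m = ℕ.≤-trans (∣p∪q∣≤∣p∣+∣q∣ A U)
        (ℕ.+-mono-≤ (ℕ.m≤n⇒m≤1+n A≤m)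
          (ℕ.≤-trans (ℕ.m≤n⇒m≤1+n U≤m) (ℕ.≤-reflexive (sym (ℕ.+-identityʳ (suc m))))))

  occupied : ∀ {k} → Cops k → Subset n
  occupied {zero}  c = ⊥
  occupied {suc k} c = maybe′ ⁅_⁆ ⊥ (c Fin.zero) ∪ occupied (c ∘′ Fin.suc)

  ∣occupied∣≤k : ∀ {k} (c : Cops k) → ∣ occupied c ∣ ℕ.≤ k
  ∣occupied∣≤k {zero}  c = ℕ.≤-reflexive (∣⊥∣≡0 n)
  ∣occupied∣≤k {suc k} c = ℕ.≤-trans
    (∣p∪q∣≤∣p∣+∣q∣ (maybe′ ⁅_⁆ ⊥ (c Fin.zero)) (occupied (c ∘′ Fin.suc)))
    (ℕ.+-mono-≤ (one (c Fin.zero)) (∣occupied∣≤k (c ∘′ Fin.suc)))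
    where
    one : ∀ x → ∣ maybe′ ⁅_⁆ ⊥ x ∣ ℕ.≤ 1
    one (just x) = ℕ.≤-reflexive (∣⁅x⁆∣≡1 x)
    one nothing  = ℕ.≤-trans (ℕ.≤-reflexive (∣⊥∣≡0 n)) z≤n

  ∈-occupied⁺ : ∀ {k} (c : Cops k) {v} → Occupied c v → v ∈ occupied c
  ∈-occupied⁺ c {v} (Fin.zero , eq) = x∈p∪q⁺ {q = occupied (c ∘′ Fin.suc)}
    (inj₁ (subst (λ x → v ∈ maybe′ ⁅_⁆ ⊥ x) (sym eq) (x∈⁅x⁆ v)))
  ∈-occupied⁺ c (Fin.suc i , eq) = x∈p∪q⁺ {p = maybe′ ⁅_⁆ ⊥ (c Fin.zero)}
    (inj₂ (∈-occupied⁺ (c ∘′ Fin.suc) (i , eq)))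

  ∈-occupied⁻ : ∀ {k} (c : Cops k) {v} → v ∈ occupied c → Occupied c v
  ∈-occupied⁻ {zero}  c v∈ = contradiction v∈ ∉⊥
  ∈-occupied⁻ {suc k} c v∈
    with x∈p∪q⁻ (maybe′ ⁅_⁆ ⊥ (c Fin.zero)) (occupied (c ∘′ Fin.suc)) v∈
  ... | inj₂ v∈ʳ with i , eq ← ∈-occupied⁻ (c ∘′ Fin.suc) v∈ʳ = Fin.suc i , eq
  ... | inj₁ v∈ˡ with c Fin.zero in eq
  ...   | just x  = Fin.zero , trans eq (cong just (sym (x∈⁅y⁆⇒x≡y x v∈ˡ)))
  ...   | nothing = contradiction v∈ˡ ∉⊥

  free : ∀ {k} → Cops k → Subset n
  free c = ∁ (occupied c)

  -- The only vertex that a cop move can newly occupy is the robber's position `r`.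
  free-move : ∀ {k} {c c′ : Cops k} {r v} → CopMove c r c′ → v ∈ free c → v ≢ r → v ∈ free c′
  free-move stay v∈ v≢r = v∈
  free-move {c = c} {r = r} {v} (fly i) v∈ v≢r =
    x∉p⇒x∈∁p (λ v∈′ → still-free (∈-occupied⁻ _ v∈′))
    where
    still-free : ¬ Occupied _ v
    still-free (j , eq) with i Fin.≟ j
    ... | yes refl = v≢r (sym (just-injective (trans (sym (updateAt-updates i c)) eq)))
    ... | no  i≢j  = x∈∁p⇒x∉p v∈
      (∈-occupied⁺ c (j , trans (sym (updateAt-minimal j i c (i≢j ∘′ sym))) eq))

  module _ {k} (room : k ℕ.+ 3 ℕ.* suc m ℕ.≤ n) where

    ∣free∣≥3m : (c : Cops k) → 3 ℕ.* suc m ℕ.≤ ∣ free c ∣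
    ∣free∣≥3m c = begin
      3 ℕ.* suc m          ≤⟨ ℕ.m+n≤o⇒m≤o∸n (3 ℕ.* suc m) (subst (ℕ._≤ n) (ℕ.+-comm k _) room) ⟩
      n ℕ.∸ k              ≤⟨ ℕ.∸-monoʳ-≤ n (∣occupied∣≤k c) ⟩
      n ℕ.∸ ∣ occupied c ∣ ≡⟨ ∣∁p∣≡n∸∣p∣ (occupied c) ⟨
      ∣ free c ∣           ∎
      where open ℕ.≤-Reasoning

    -- Induction on the strategy tree. All legal answers of the robber lead to trapped vertices,
    -- which `cover` collects in a small set `U` closed inside `free c′`. Adding `r` makes the set
    -- closed inside the larger `free c`: a vertex free in `c` is either `r`, which is included, or
    -- still free in `c′`, by `free-move`.
    copsWin⇒small : ∀ {c : Cops k} {r} → CopsWin c r → Small (free c) r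
    copsWin⇒small {c} {r} (turn {c′} move next)
      with U , cU , U≤m , U∋ ← cover (λ v → E? r v ×-dec v ∈? free c′) (∣free∣≥3m c′)
             (λ v (Erv , v∈) →
               copsWin⇒small (next v Erv (λ occ → x∈∁p⇒x∉p v∈ (∈-occupied⁺ c′ occ))))
      = A , closed , gap (∣free∣≥3m c) closed A≤2m , x∈p∪q⁺ {q = U} (inj₁ (x∈⁅x⁆ r))
      where
      A = ⁅ r ⁆ ∪ U
      closed : Closed (free c) A
      closed {u} {v} u∈A v∈F Euv with v Fin.≟ r
      ... | yes refl = x∈p∪q⁺ {q = U} (inj₁ (x∈⁅x⁆ r))
      ... | no  v≢r with x∈p∪q⁻ ⁅ r ⁆ U u∈A
      -- An arc from `r` to a vertex free in `c′` is a legal move of the robber, so its end is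
      -- covered by `U`.
      ...   | inj₁ u∈r = x∈p∪q⁺ {p = ⁅ r ⁆} (inj₂ (U∋ v
                (subst (λ x → E x v) (x∈⁅y⁆⇒x≡y r u∈r) Euv , free-move move v∈F v≢r)))
      ...   | inj₂ u∈U = x∈p∪q⁺ {p = ⁅ r ⁆} (inj₂ (cU u∈U (free-move move v∈F v≢r) Euv))
      A≤2m : ∣ A ∣ ℕ.≤ 2 ℕ.* suc m
      A≤2m = begin
        ∣ A ∣               ≤⟨ ∣p∪q∣≤∣p∣+∣q∣ ⁅ r ⁆ U ⟩
        ∣ ⁅ r ⁆ ∣ ℕ.+ ∣ U ∣ ≡⟨ cong (ℕ._+ ∣ U ∣) (∣⁅x⁆∣≡1 r) ⟩
        suc ∣ U ∣           ≤⟨ s≤s U≤m ⟩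
        suc m               ≤⟨ ℕ.m≤m+n (suc m) _ ⟩
        2 ℕ.* suc m         ∎
        where open ℕ.≤-Reasoning

    robberEscapes : ¬ CopsCatch E k
    robberEscapes win
      -- Every starting vertex is trapped, so covering all vertices at once gives `n ≤ m`, while
      -- `room` gives `n > m`.
      with U , _ , U≤m , U∋ ← cover {Q = λ _ → Unit} (λ _ → yes tt) (∣free∣≥3m (λ _ → nothing))
             (λ v _ → copsWin⇒small (win v))
      = ℕ.<⇒≱ (ℕ.<-≤-trans (ℕ.m≤m+n (suc m) _) (ℕ.≤-trans (ℕ.m≤n+m _ k) room)) n≤m
      where
      n≤m : n ℕ.≤ m
      n≤m = ℕ.≤-trans (ℕ.≤-reflexive (sym (∣⊤∣≡n n)))
              (ℕ.≤-trans (p⊆q⇒∣p∣≤∣q∣ {p = ⊤} (λ {x} _ → U∋ x tt)) U≤m)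

-- Finite sums, and counting the vertex pairs between two sets.

bit : Bool → ℕ
bit b = if b then 1 else 0

∑ : ∀ {A : Set} → List A → (A → ℕ) → ℕ
∑ xs f = sum (map f xs)

module _ {A : Set} where

  ∑-mono : ∀ {f g : A → ℕ} xs → (∀ x → f x ℕ.≤ g x) → ∑ xs f ℕ.≤ ∑ xs g
  ∑-mono []       f≤g = z≤n
  ∑-mono (x ∷ xs) f≤g = ℕ.+-mono-≤ (f≤g x) (∑-mono xs f≤g)

  ∑-cong : ∀ {f g : A → ℕ} xs → (∀ x → f x ≡ g x) → ∑ xs f ≡ ∑ xs g
  ∑-cong xs f≡g = cong sum (List.map-cong f≡g xs)

  ∑-+ : ∀ (f g : A → ℕ) xs → ∑ xs (λ x → f x ℕ.+ g x) ≡ ∑ xs f ℕ.+ ∑ xs g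
  ∑-+ f g []       = refl
  ∑-+ f g (x ∷ xs) rewrite ∑-+ f g xs =
    solve 4 (λ a b c d → (a :+ b) :+ (c :+ d) := (a :+ c) :+ (b :+ d)) refl
      (f x) (g x) (∑ xs f) (∑ xs g)
    where open ℕ-Solver

  ∑-*ˡ : ∀ c (f : A → ℕ) xs → ∑ xs (λ x → c ℕ.* f x) ≡ c ℕ.* ∑ xs f
  ∑-*ˡ c f []       = sym (ℕ.*-zeroʳ c)
  ∑-*ˡ c f (x ∷ xs) rewrite ∑-*ˡ c f xs = sym (ℕ.*-distribˡ-+ c (f x) (∑ xs f))

  ∑-*ʳ : ∀ c (f : A → ℕ) xs → ∑ xs (λ x → f x ℕ.* c) ≡ ∑ xs f ℕ.* c
  ∑-*ʳ c f []       = refl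
  ∑-*ʳ c f (x ∷ xs) rewrite ∑-*ʳ c f xs = sym (ℕ.*-distribʳ-+ c (f x) (∑ xs f))

  ∑-0 : ∀ (xs : List A) → ∑ xs (λ _ → 0) ≡ 0
  ∑-0 []       = refl
  ∑-0 (x ∷ xs) = ∑-0 xs

  ∑-++ : ∀ (f : A → ℕ) xs ys → ∑ (xs ++ ys) f ≡ ∑ xs f ℕ.+ ∑ ys f
  ∑-++ f []       ys = refl
  ∑-++ f (x ∷ xs) ys rewrite ∑-++ f xs ys = sym (ℕ.+-assoc (f x) _ _)

  ∑-filter : ∀ {P : Pred A 0ℓ} (P? : Unary.Decidable P) (f : A → ℕ) xs →
    ∑ (filter P? xs) f ≡ ∑ xs (λ x → if does (P? x) then f x else 0)
  ∑-filter P? f []       = refl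
  ∑-filter P? f (x ∷ xs) with does (P? x)
  ... | true  = cong (f x ℕ.+_) (∑-filter P? f xs)
  ... | false = ∑-filter P? f xs

∑-swap : ∀ {A B : Set} (f : A → B → ℕ) xs ys →
  ∑ xs (λ x → ∑ ys (f x)) ≡ ∑ ys (λ y → ∑ xs (λ x → f x y))
∑-swap f []       ys = sym (∑-0 ys)
∑-swap f (x ∷ xs) ys rewrite ∑-swap f xs ys = sym (∑-+ (f x) _ ys)

∑-cartesianProduct : ∀ {A B : Set} (f : A × B → ℕ) xs ys →
  ∑ (cartesianProduct xs ys) f ≡ ∑ xs (λ x → ∑ ys (λ y → f (x , y)))
∑-cartesianProduct f []       ys = refl
∑-cartesianProduct f (x ∷ xs) ys = trans
  (∑-++ f (map (x ,_) ys) (cartesianProduct xs ys))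
  (cong₂ ℕ._+_ (cong sum (sym (List.map-∘ ys))) (∑-cartesianProduct f xs ys))

∑-allFin : ∀ {n} (f : Fin (suc n) → ℕ) →
  ∑ (allFin (suc n)) f ≡ f Fin.zero ℕ.+ ∑ (allFin n) (f ∘′ Fin.suc)
∑-allFin {n} f = cong (f Fin.zero ℕ.+_) (cong sum (begin
  map f (List.tabulate Fin.suc)      ≡⟨ List.map-tabulate Fin.suc f ⟩
  List.tabulate (f ∘′ Fin.suc)       ≡⟨ List.map-tabulate id (f ∘′ Fin.suc) ⟨
  map (f ∘′ Fin.suc) (allFin n)      ∎))
  where open ≡-Reasoning

∣p∣≡∑ : ∀ {n} (p : Subset n) → ∣ p ∣ ≡ ∑ (allFin n) (λ x → bit (Vec.lookup p x))
∣p∣≡∑ []            = refl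
∣p∣≡∑ (inside  ∷ p) = trans (cong suc (∣p∣≡∑ p)) (sym (∑-allFin (λ x → bit (Vec.lookup (inside ∷ p) x))))
∣p∣≡∑ (outside ∷ p) = trans (∣p∣≡∑ p) (sym (∑-allFin (λ x → bit (Vec.lookup (outside ∷ p) x))))

-- A random graph is a subset of positions in the list of pairs; a property of pairs is turned into
-- a subset of the same type.
indices : ∀ {A : Set} → (A → Bool) → (xs : List A) → Subset (length xs)
indices g xs = Vec.tabulate (λ e → g (List.lookup xs e))

∣indices∣ : ∀ {A : Set} (g : A → Bool) xs → ∣ indices g xs ∣ ≡ ∑ xs (λ x → bit (g x))
∣indices∣ g []       = refl
∣indices∣ g (x ∷ xs) with g x
... | true  = cong suc (∣indices∣ g xs)
... | false = ∣indices∣ g xs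

∈-indices : ∀ {A : Set} (g : A → Bool) xs {e} → e ∈ indices g xs → g (List.lookup xs e) ≡ true
∈-indices g xs {e} e∈ = trans (sym (Vec.lookup∘tabulate _ e)) (Vec.[]=⇒lookup e∈)

∧-true : ∀ {a b} → a ∧ b ≡ true → a ≡ true × b ≡ true
∧-true {true} {true} _ = refl , refl

module _ {n} (A B : Subset n) where

  -- An undirected edge is listed in one orientation only, so `crossing` tests both.
  forward crossing : Fin n × Fin n → Bool
  forward  (u , v) = Vec.lookup A u ∧ Vec.lookup B v
  crossing (u , v) = forward (u , v) ∨ forward (v , u)

  forward⁻ : ∀ {u v} → forward (u , v) ≡ true → u ∈ A × v ∈ B
  forward⁻ {u} {v} eq with a , b ← ∧-true {Vec.lookup A u} eq =
    Vec.lookup⇒[]= u A a , Vec.lookup⇒[]= v B b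

  crossing⁻ : ∀ {u v} → crossing (u , v) ≡ true → (u ∈ A × v ∈ B) ⊎ (v ∈ A × u ∈ B)
  crossing⁻ {u} {v} eq with forward (u , v) in uv
  ... | true  = inj₁ (forward⁻ uv)
  ... | false = inj₂ (forward⁻ eq)

  private
    ab : Fin n → Fin n → ℕ
    ab u v = bit (Vec.lookup A u) ℕ.* bit (Vec.lookup B v)

    ∑∑ab : ∑ (allFin n) (λ u → ∑ (allFin n) (ab u)) ≡ ∣ A ∣ ℕ.* ∣ B ∣
    ∑∑ab = begin
      ∑ (allFin n) (λ u → ∑ (allFin n) (ab u))
        ≡⟨ ∑-cong (allFin n) (λ u → trans (∑-*ˡ (bit (Vec.lookup A u)) _ (allFin n))
             (cong (bit (Vec.lookup A u) ℕ.*_) (sym (∣p∣≡∑ B)))) ⟩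
      ∑ (allFin n) (λ u → bit (Vec.lookup A u) ℕ.* ∣ B ∣)
        ≡⟨ ∑-*ʳ ∣ B ∣ _ (allFin n) ⟩
      ∑ (allFin n) (λ u → bit (Vec.lookup A u)) ℕ.* ∣ B ∣
        ≡⟨ cong (ℕ._* ∣ B ∣) (∣p∣≡∑ A) ⟨
      ∣ A ∣ ℕ.* ∣ B ∣ ∎
      where open ≡-Reasoning

    ∑-pairs : ∀ {P : Pred (Fin n × Fin n) 0ℓ} (P? : Unary.Decidable P) (g : Fin n × Fin n → Bool) →
      ∣ indices g (filter P? (cartesianProduct (allFin n) (allFin n))) ∣ ≡
      ∑ (allFin n) (λ u → ∑ (allFin n) (λ v → if does (P? (u , v)) then bit (g (u , v)) else 0))
    ∑-pairs P? g =
      trans (∣indices∣ g (filter P? pairs)) (trans (∑-filter P? (λ e → bit (g e)) pairs)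
        (∑-cartesianProduct (λ e → if does (P? e) then bit (g e) else 0) (allFin n) (allFin n)))
      where pairs = cartesianProduct (allFin n) (allFin n)

  module _ (disjoint : ∀ {x} → x ∈ A → x ∉ B) where

    private
      disjointᵇ : ∀ u → Vec.lookup A u ∧ Vec.lookup B u ≡ false
      disjointᵇ u with Vec.lookup A u in a | Vec.lookup B u in b
      ... | true  | true  = contradiction (Vec.lookup⇒[]= u B b) (disjoint (Vec.lookup⇒[]= u A a))
      ... | true  | false = refl
      ... | false | _     = refl

      bit-∧ : ∀ a b → bit a ℕ.* bit b ≡ bit (a ∧ b)
      bit-∧ false b = refl
      bit-∧ true  b = ℕ.+-identityʳ (bit b)

      ab-diagonal : ∀ u → ab u u ≡ 0
      ab-diagonal u = trans (bit-∧ (Vec.lookup A u) (Vec.lookup B u)) (cong bit (disjointᵇ u))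

      -- In the application `a` and `d` say that one vertex lies in `A` and in `B`. By disjointness
      -- they exclude each other, so at most one of the two products is 1.
      bit-∨ : ∀ a b c d → a ∧ d ≡ false →
        bit a ℕ.* bit b ℕ.+ bit c ℕ.* bit d ℕ.≤ bit (a ∧ b ∨ c ∧ d)
      bit-∨ false b     c d     _ = ℕ.≤-reflexive (bit-∧ c d)
      bit-∨ true  true  c false _ = ℕ.≤-reflexive (cong suc (ℕ.*-zeroʳ (bit c)))
      bit-∨ true  false c false _ =
        ℕ.≤-trans (ℕ.≤-reflexive (ℕ.*-zeroʳ (bit c))) z≤n

    ∣forward∣ : ∣ A ∣ ℕ.* ∣ B ∣ ℕ.≤ ∣ indices forward (orderedPairs n) ∣
    ∣forward∣ = begin
      ∣ A ∣ ℕ.* ∣ B ∣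
        ≡⟨ ∑∑ab ⟨
      ∑ (allFin n) (λ u → ∑ (allFin n) (ab u))
        ≤⟨ ∑-mono (allFin n) (λ u → ∑-mono (allFin n) (pointwise u)) ⟩
      ∑ (allFin n) (λ u → ∑ (allFin n) (λ v →
        if not (does (u Fin.≟ v)) then bit (forward (u , v)) else 0))
        ≡⟨ ∑-pairs _ forward ⟨
      ∣ indices forward (orderedPairs n) ∣ ∎
      where
      open ℕ.≤-Reasoning
      pointwise : ∀ u v → ab u v ℕ.≤ (if not (does (u Fin.≟ v)) then bit (forward (u , v)) else 0)
      pointwise u v with u Fin.≟ v
      ... | yes refl = ℕ.≤-reflexive (ab-diagonal u)
      ... | no  _    = ℕ.≤-reflexive (bit-∧ (Vec.lookup A u) (Vec.lookup B v))

    -- The sum over ordered pairs is folded onto the pairs with `u < v`: the terms with `v < u` are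
    -- moved there by exchanging the summations, and the diagonal vanishes by disjointness. By
    -- `bit-∨` no unordered pair receives a total above its indicator.
    ∣crossing∣ : ∣ A ∣ ℕ.* ∣ B ∣ ℕ.≤ ∣ indices crossing (unorderedPairs n) ∣
    ∣crossing∣ = begin
      ∣ A ∣ ℕ.* ∣ B ∣
        ≡⟨ ∑∑ab ⟨
      ∑ (allFin n) (λ u → ∑ (allFin n) (ab u))
        ≤⟨ ∑-mono (allFin n) (λ u → ∑-mono (allFin n) (split u)) ⟩
      ∑ (allFin n) (λ u → ∑ (allFin n) (λ v → below u v (ab u v) ℕ.+ below v u (ab u v)))
        ≡⟨ ∑∑-+ (λ u v → below u v (ab u v)) (λ u v → below v u (ab u v)) ⟩
      ∑ (allFin n) (λ u → ∑ (allFin n) (λ v → below u v (ab u v))) ℕ.+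
      ∑ (allFin n) (λ u → ∑ (allFin n) (λ v → below v u (ab u v)))
        ≡⟨ cong (∑ (allFin n) (λ u → ∑ (allFin n) (λ v → below u v (ab u v))) ℕ.+_)
             (∑-swap (λ u v → below v u (ab u v)) (allFin n) (allFin n)) ⟩
      ∑ (allFin n) (λ u → ∑ (allFin n) (λ v → below u v (ab u v))) ℕ.+
      ∑ (allFin n) (λ u → ∑ (allFin n) (λ v → below u v (ab v u)))
        ≡⟨ ∑∑-+ (λ u v → below u v (ab u v)) (λ u v → below u v (ab v u)) ⟨
      ∑ (allFin n) (λ u → ∑ (allFin n) (λ v → below u v (ab u v) ℕ.+ below u v (ab v u)))
        ≤⟨ ∑-mono (allFin n) (λ u → ∑-mono (allFin n) (join u)) ⟩
      ∑ (allFin n) (λ u → ∑ (allFin n) (λ v → below u v (bit (crossing (u , v)))))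
        ≡⟨ ∑-pairs _ crossing ⟨
      ∣ indices crossing (unorderedPairs n) ∣ ∎
      where
      open ℕ.≤-Reasoning
      below : Fin n → Fin n → ℕ → ℕ
      below u v x = if does (u Fin.<? v) then x else 0

      below-yes : ∀ {u v} x → u Fin.< v → below u v x ≡ x
      below-yes {u} {v} x u<v = cong (λ b → if b then x else 0) (dec-true (u Fin.<? v) u<v)

      ∑∑-+ : ∀ (f g : Fin n → Fin n → ℕ) →
        ∑ (allFin n) (λ u → ∑ (allFin n) (λ v → f u v ℕ.+ g u v)) ≡
        ∑ (allFin n) (λ u → ∑ (allFin n) (f u)) ℕ.+ ∑ (allFin n) (λ u → ∑ (allFin n) (g u))
      ∑∑-+ f g = trans (∑-cong (allFin n) (λ u → ∑-+ (f u) (g u) (allFin n)))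
        (∑-+ (λ u → ∑ (allFin n) (f u)) (λ u → ∑ (allFin n) (g u)) (allFin n))

      split : ∀ u v → ab u v ℕ.≤ below u v (ab u v) ℕ.+ below v u (ab u v)
      split u v with Fin.<-cmp u v
      ... | tri< u<v _ _ = ℕ.≤-trans (ℕ.≤-reflexive (sym (below-yes _ u<v))) (ℕ.m≤m+n _ _)
      ... | tri≈ _ refl _ = ℕ.≤-trans (ℕ.≤-reflexive (ab-diagonal u)) z≤n
      ... | tri> _ _ v<u = ℕ.≤-trans (ℕ.≤-reflexive (sym (below-yes _ v<u))) (ℕ.m≤n+m _ _)

      join : ∀ u v → below u v (ab u v) ℕ.+ below u v (ab v u) ℕ.≤ below u v (bit (crossing (u , v)))
      join u v with does (u Fin.<? v)
      ... | true  = bit-∨ (Vec.lookup A u) (Vec.lookup B v) (Vec.lookup A v) (Vec.lookup B u) (disjointᵇ u)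
      ... | false = z≤n

-- Rational arithmetic and the embedding of the naturals.

*-monoˡ : ∀ {a b c} → 0ℚ ℚ.≤ a → b ℚ.≤ c → a ℚ.* b ℚ.≤ a ℚ.* c
*-monoˡ {a} 0≤a = ℚ.*-monoˡ-≤-nonNeg a {{ℚ.nonNegative 0≤a}}

*-monoʳ : ∀ {a b c} → 0ℚ ℚ.≤ a → b ℚ.≤ c → b ℚ.* a ℚ.≤ c ℚ.* a
*-monoʳ {a} 0≤a = ℚ.*-monoʳ-≤-nonNeg a {{ℚ.nonNegative 0≤a}}

0≤* : ∀ {a b} → 0ℚ ℚ.≤ a → 0ℚ ℚ.≤ b → 0ℚ ℚ.≤ a ℚ.* b
0≤* {a} {b} 0≤a 0≤b = subst (ℚ._≤ a ℚ.* b) (ℚ.*-zeroʳ a) (*-monoˡ 0≤a 0≤b)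

0<* : ∀ {a b} → 0ℚ ℚ.< a → 0ℚ ℚ.< b → 0ℚ ℚ.< a ℚ.* b
0<* {a} {b} 0<a 0<b =
  subst (ℚ._< a ℚ.* b) (ℚ.*-zeroʳ a) (ℚ.*-monoʳ-<-pos a {{ℚ.positive 0<a}} 0<b)

0≤^ : ∀ {a} n → 0ℚ ℚ.≤ a → 0ℚ ℚ.≤ a ^ n
0≤^ zero    0≤a = ℚ.nonNegative⁻¹ 1ℚ
0≤^ (suc n) 0≤a = 0≤* 0≤a (0≤^ n 0≤a)

^≤1 : ∀ {a} n → 0ℚ ℚ.≤ a → a ℚ.≤ 1ℚ → a ^ n ℚ.≤ 1ℚ
^≤1         zero    0≤a a≤1 = ℚ.≤-refl
^≤1 {a} (suc n) 0≤a a≤1 =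
  ℚ.≤-trans (*-monoˡ 0≤a (^≤1 n 0≤a a≤1)) (subst (ℚ._≤ 1ℚ) (sym (ℚ.*-identityʳ a)) a≤1)

^-antimono : ∀ {a m n} → 0ℚ ℚ.≤ a → a ℚ.≤ 1ℚ → m ℕ.≤ n → a ^ n ℚ.≤ a ^ m
^-antimono {n = n} 0≤a a≤1 z≤n       = ^≤1 n 0≤a a≤1
^-antimono         0≤a a≤1 (s≤s m≤n) = *-monoˡ 0≤a (^-antimono 0≤a a≤1 m≤n)

p≤q⇒0≤q-p : ∀ {p q} → p ℚ.≤ q → 0ℚ ℚ.≤ q ℚ.- p
p≤q⇒0≤q-p {p} {q} p≤q = subst (ℚ._≤ q ℚ.- p) (ℚ.+-inverseʳ p) (ℚ.+-monoˡ-≤ (ℚ.- p) p≤q)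

∣p∣≤q : ∀ p {q} → p ℚ.≤ q → ℚ.- p ℚ.≤ q → ℚ.∣ p ∣ ℚ.≤ q
∣p∣≤q p {q} p≤q -p≤q with ℚ.∣p∣≡p∨∣p∣≡-p p
... | inj₁ eq = subst (ℚ._≤ q) (sym eq) p≤q
... | inj₂ eq = subst (ℚ._≤ q) (sym eq) -p≤q

-- The constant value of the sequence `fromℕ n`, so that inequalities between reals unfold to
-- inequalities about `ι`.
ι : ℕ → ℚ
ι n = + n ℚ./ 1

private
  ιᵘ : ℕ → ℚᵘ.ℚᵘ
  ιᵘ n = mkℚᵘ (+ n) 0

  toℚᵘ-ι : ∀ n → ℚ.toℚᵘ (ι n) ℚᵘ.≃ ιᵘ n
  toℚᵘ-ι n = ℚ.toℚᵘ-fromℚᵘ (ιᵘ n)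

-- Division normalises by a gcd, which is stuck on variables; the identity is checked on
-- unnormalised fractions instead.
ι-+ : ∀ m n → ι (m ℕ.+ n) ≡ ι m ℚ.+ ι n
ι-+ m n = ℚ.toℚᵘ-injective (begin
  ℚ.toℚᵘ (ι (m ℕ.+ n))              ≈⟨ toℚᵘ-ι (m ℕ.+ n) ⟩
  ιᵘ (m ℕ.+ n)
    ≈⟨ *≡* (cong (ℤ._* + 1) (sym (cong₂ ℤ._+_ (ℤ.*-identityʳ (+ m)) (ℤ.*-identityʳ (+ n))))) ⟩
  ιᵘ m ℚᵘ.+ ιᵘ n                    ≈⟨ ℚᵘ.+-cong (toℚᵘ-ι m) (toℚᵘ-ι n) ⟨
  ℚ.toℚᵘ (ι m) ℚᵘ.+ ℚ.toℚᵘ (ι n)    ≈⟨ ℚ.toℚᵘ-homo-+ (ι m) (ι n) ⟨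
  ℚ.toℚᵘ (ι m ℚ.+ ι n)              ∎)
  where open ℚᵘ.≃-Reasoning

ι-* : ∀ m n → ι (m ℕ.* n) ≡ ι m ℚ.* ι n
ι-* zero    n = sym (ℚ.*-zeroˡ (ι n))
ι-* (suc m) n = begin
  ι (n ℕ.+ m ℕ.* n)               ≡⟨ ι-+ n (m ℕ.* n) ⟩
  ι n ℚ.+ ι (m ℕ.* n)             ≡⟨ cong₂ ℚ._+_ (sym (ℚ.*-identityˡ (ι n))) (ι-* m n) ⟩
  1ℚ ℚ.* ι n ℚ.+ ι m ℚ.* ι n      ≡⟨ ℚ.*-distribʳ-+ (ι n) 1ℚ (ι m) ⟨
  (1ℚ ℚ.+ ι m) ℚ.* ι n            ≡⟨ cong (ℚ._* ι n) (ι-+ 1 m) ⟨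
  ι (suc m) ℚ.* ι n               ∎
  where open ≡-Reasoning

ι-^ : ∀ m n → ι (m ℕ.^ n) ≡ ι m ^ n
ι-^ m zero    = refl
ι-^ m (suc n) = trans (ι-* m (m ℕ.^ n)) (cong (ι m ℚ.*_) (ι-^ m n))

0≤ι : ∀ n → 0ℚ ℚ.≤ ι n
0≤ι n = ℚ.nonNegative⁻¹ (ι n) {{ℚ.normalize-nonNeg n 1}}

ι-mono-≤ : ∀ {m n} → m ℕ.≤ n → ι m ℚ.≤ ι n
ι-mono-≤ {m} {n} m≤n = begin
  ι m                     ≡⟨ ℚ.+-identityʳ (ι m) ⟨
  ι m ℚ.+ 0ℚ              ≤⟨ ℚ.+-monoʳ-≤ (ι m) (0≤ι (n ℕ.∸ m)) ⟩
  ι m ℚ.+ ι (n ℕ.∸ m)     ≡⟨ ι-+ m (n ℕ.∸ m) ⟨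
  ι (m ℕ.+ (n ℕ.∸ m))     ≡⟨ cong ι (ℕ.m+[n∸m]≡n m≤n) ⟩
  ι n                     ∎
  where open ℚ.≤-Reasoning

ι-cancel-≤ : ∀ {m n} → ι m ℚ.≤ ι n → m ℕ.≤ n
ι-cancel-≤ {m} {n} ιm≤ιn with m ℕ.≤? n
... | yes m≤n = m≤n
... | no  m≰n = contradiction refl (λ eq → ℚ.<-irrefl eq (begin-strict
  ι n               ≡⟨ ℚ.+-identityˡ (ι n) ⟨
  0ℚ ℚ.+ ι n        <⟨ ℚ.+-monoˡ-< (ι n) (ℚ.positive⁻¹ 1ℚ) ⟩
  1ℚ ℚ.+ ι n        ≡⟨ ι-+ 1 n ⟨
  ι (suc n)         ≤⟨ ι-mono-≤ (ℕ.≰⇒> m≰n) ⟩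
  ι m               ≤⟨ ιm≤ιn ⟩
  ι n               ∎))
  where open ℚ.≤-Reasoning

ι-inverse : ∀ n .{{_ : ℕ.NonZero n}} → ι n ℚ.* (+ 1 ℚ./ n) ≡ 1ℚ
ι-inverse n@(suc k) = ℚ.toℚᵘ-injective (begin
  ℚ.toℚᵘ (ι n ℚ.* (+ 1 ℚ./ n))               ≈⟨ ℚ.toℚᵘ-homo-* (ι n) (+ 1 ℚ./ n) ⟩
  ℚ.toℚᵘ (ι n) ℚᵘ.* ℚ.toℚᵘ (+ 1 ℚ./ n)       ≈⟨ ℚᵘ.*-cong (toℚᵘ-ι n) (ℚ.toℚᵘ-fromℚᵘ (mkℚᵘ (+ 1) k)) ⟩
  ιᵘ n ℚᵘ.* mkℚᵘ (+ 1) k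
    ≈⟨ *≡* (cong +_ (trans (ℕ.*-identityʳ (n ℕ.* 1))
         (trans (ℕ.*-comm n 1) (sym (ℕ.*-identityˡ (1 ℕ.* n)))))) ⟩
  ℚᵘ.1ℚᵘ                                     ∎)
  where open ℚᵘ.≃-Reasoning

-- The witness is the denominator of `x` (stored as its predecessor `b`): multiplying by it leaves
-- the numerator, which is at least 1.
archimedean : ∀ x → 0ℚ ℚ.< x → ∃[ d ] 1ℚ ℚ.≤ ι (suc d) ℚ.* x
archimedean x@(mkℚ (+ suc a) b _) _ = b , subst (1ℚ ℚ.≤_) (sym (ℚ.toℚᵘ-injective (begin
  ℚ.toℚᵘ (ι (suc b) ℚ.* x)                   ≈⟨ ℚ.toℚᵘ-homo-* (ι (suc b)) x ⟩
  ℚ.toℚᵘ (ι (suc b)) ℚᵘ.* ℚ.toℚᵘ x           ≈⟨ ℚᵘ.*-congʳ (toℚᵘ-ι (suc b)) ⟩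
  ιᵘ (suc b) ℚᵘ.* mkℚᵘ (+ suc a) b
    ≈⟨ *≡* (cong +_ (trans (ℕ.*-identityʳ (suc b ℕ.* suc a))
         (trans (ℕ.*-comm (suc b) (suc a)) (cong (suc a ℕ.*_) (sym (ℕ.*-identityˡ (suc b))))))) ⟩
  ιᵘ (suc a)                                 ≈⟨ toℚᵘ-ι (suc a) ⟨
  ℚ.toℚᵘ (ι (suc a))                         ∎))) (ι-mono-≤ {1} {suc a} (s≤s z≤n))
  where open ℚᵘ.≃-Reasoning
archimedean (mkℚ (+ 0) b _)       (ℚ.*<* (ℤ.+<+ ()))
archimedean (mkℚ (ℤ.-[1+ a ]) b _) (ℚ.*<* ())

-- Probabilities with a rational parameter.

-- Conditioning on the first element gives a polynomial in `q`. It makes sense for every rational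
-- `q`, also for approximations of a probability that fall outside [0,1].
Prob : ℚ → ∀ {m} → (Subset m → Bool) → ℚ
Prob q {zero}  B = if B [] then 1ℚ else 0ℚ
Prob q {suc m} B =
  q ℚ.* Prob q (λ S → B (inside ∷ S)) ℚ.+ (1ℚ ℚ.- q) ℚ.* Prob q (λ S → B (outside ∷ S))

factor : ℚ → Bool → ℚ
factor q b = if b then q else 1ℚ ℚ.- q

weightℚ : ℚ → ∀ {m} → Subset m → ℚ
weightℚ q []      = 1ℚ
weightℚ q (b ∷ S) = factor q b ℚ.* weightℚ q S

totalℚ : ℚ → ∀ {m} → List (Subset m) → ℚ
totalℚ q []       = 0ℚ
totalℚ q (S ∷ Ss) = weightℚ q S ℚ.+ totalℚ q Ss

seq-weight : ∀ p j {m} (S : Subset m) → seq (weight p S) j ≡ weightℚ (seq p j) S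
seq-weight p j []            = refl
seq-weight p j (inside  ∷ S) = cong (seq p j ℚ.*_) (seq-weight p j S)
seq-weight p j (outside ∷ S) = cong ((1ℚ ℚ.- seq p j) ℚ.*_) (seq-weight p j S)

seq-total : ∀ p j {m} (Ss : List (Subset m)) →
  seq (foldr (λ S s → weight p S + s) 0ℝ Ss) j ≡ totalℚ (seq p j) Ss
seq-total p j []       = refl
seq-total p j (S ∷ Ss) = cong₂ ℚ._+_ (seq-weight p j S) (seq-total p j Ss)

module _ (q : ℚ) where

  totalℚ-++ : ∀ {m} (Ss Ts : List (Subset m)) → totalℚ q (Ss ++ Ts) ≡ totalℚ q Ss ℚ.+ totalℚ q Ts
  totalℚ-++ []       Ts = sym (ℚ.+-identityˡ (totalℚ q Ts))
  totalℚ-++ (S ∷ Ss) Ts = trans (cong (weightℚ q S ℚ.+_) (totalℚ-++ Ss Ts))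
    (sym (ℚ.+-assoc (weightℚ q S) (totalℚ q Ss) (totalℚ q Ts)))

  totalℚ-map : ∀ {m} b (B : Subset (suc m) → Bool) Ss →
    totalℚ q (filterᵇ B (map (b ∷_) Ss)) ≡ factor q b ℚ.* totalℚ q (filterᵇ (λ S → B (b ∷ S)) Ss)
  totalℚ-map b B []       = sym (ℚ.*-zeroʳ (factor q b))
  totalℚ-map b B (S ∷ Ss) with B (b ∷ S)
  ... | false = totalℚ-map b B Ss
  ... | true  = trans (cong (weightℚ q (b ∷ S) ℚ.+_) (totalℚ-map b B Ss))
    (sym (ℚ.*-distribˡ-+ (factor q b) (weightℚ q S) (totalℚ q (filterᵇ (λ S → B (b ∷ S)) Ss))))

  totalℚ-Prob : ∀ {m} (B : Subset m → Bool) → totalℚ q (filterᵇ B (subsets m)) ≡ Prob q B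
  totalℚ-Prob {zero}  B with B []
  ... | true  = refl
  ... | false = refl
  totalℚ-Prob {suc m} B = begin
    totalℚ q (filterᵇ B (ins ++ outs))
      ≡⟨ cong (totalℚ q) (List.filter-++ _ ins outs) ⟩
    totalℚ q (filterᵇ B ins ++ filterᵇ B outs)
      ≡⟨ totalℚ-++ (filterᵇ B ins) (filterᵇ B outs) ⟩
    totalℚ q (filterᵇ B ins) ℚ.+ totalℚ q (filterᵇ B outs)
      ≡⟨ cong₂ ℚ._+_ (totalℚ-map inside B (subsets m)) (totalℚ-map outside B (subsets m)) ⟩
    q ℚ.* totalℚ q (filterᵇ (λ S → B (inside ∷ S)) (subsets m)) ℚ.+
    (1ℚ ℚ.- q) ℚ.* totalℚ q (filterᵇ (λ S → B (outside ∷ S)) (subsets m))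
      ≡⟨ cong₂ (λ x y → q ℚ.* x ℚ.+ (1ℚ ℚ.- q) ℚ.* y)
           (totalℚ-Prob (λ S → B (inside ∷ S))) (totalℚ-Prob (λ S → B (outside ∷ S))) ⟩
    Prob q B ∎
    where
    open ≡-Reasoning
    ins outs : List (Subset (suc m))
    ins  = map (inside ∷_) (subsets m)
    outs = map (outside ∷_) (subsets m)

-- Arithmetic on reals is termwise, so the terms of a real probability are the values of the
-- polynomial `Prob` at the approximations of `p`. All estimates can then be made over the
-- rationals.
seq-Pr : ∀ p j {m} (B : Subset m → Bool) → seq (Pr p B) j ≡ Prob (seq p j) B
seq-Pr p j {m} B = trans (seq-total p j (filterᵇ B (subsets m))) (totalℚ-Prob (seq p j) B)

misses : ∀ {m} → Subset m → Subset m → Bool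
misses []      []      = true
misses (a ∷ M) (s ∷ S) = not (a ∧ s) ∧ misses M S

hits : ∀ {m} → Subset m → Subset m → Bool
hits M S = not (misses M S)

hits⁻ : ∀ {m} (M S : Subset m) → T (hits M S) → ∃[ e ] e ∈ M × e ∈ S
hits⁻ []            []            ()
hits⁻ (inside  ∷ M) (inside  ∷ S) _ = Fin.zero , Vec.here , Vec.here
hits⁻ (inside  ∷ M) (outside ∷ S) h with e , e∈M , e∈S ← hits⁻ M S h =
  Fin.suc e , Vec.there e∈M , Vec.there e∈S
hits⁻ (outside ∷ M) (s       ∷ S) h with e , e∈M , e∈S ← hits⁻ M S h =
  Fin.suc e , Vec.there e∈M , Vec.there e∈S

hitsAll : ∀ {m} → List (Subset m) → Subset m → Bool
hitsAll Ms S = all (λ M → hits M S) Ms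

-- Independent choices with a rational probability in [0,1].

module Bernoulli {q : ℚ} (0≤q : 0ℚ ℚ.≤ q) (q≤1 : q ℚ.≤ 1ℚ) where

  r : ℚ
  r = 1ℚ ℚ.- q

  0≤r : 0ℚ ℚ.≤ r
  0≤r = p≤q⇒0≤q-p q≤1

  q+r≡1 : q ℚ.+ r ≡ 1ℚ
  q+r≡1 = solve 1 (λ q → q :+ (con 1ℚ :- q) := con 1ℚ) refl q
    where open ℚ-Solver

  average : ∀ x → q ℚ.* x ℚ.+ r ℚ.* x ≡ x
  average x = trans (sym (ℚ.*-distribʳ-+ x q r)) (trans (cong (ℚ._* x) q+r≡1) (ℚ.*-identityˡ x))

  average-mono : ∀ {a b c d} → a ℚ.≤ b → c ℚ.≤ d → q ℚ.* a ℚ.+ r ℚ.* c ℚ.≤ q ℚ.* b ℚ.+ r ℚ.* d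
  average-mono a≤b c≤d = ℚ.+-mono-≤ (*-monoˡ 0≤q a≤b) (*-monoˡ 0≤r c≤d)

  r≤1 : r ℚ.≤ 1ℚ
  r≤1 = begin
    r              ≡⟨ ℚ.+-identityˡ r ⟨
    0ℚ ℚ.+ r       ≤⟨ ℚ.+-monoˡ-≤ r 0≤q ⟩
    q ℚ.+ r        ≡⟨ q+r≡1 ⟩
    1ℚ             ∎
    where open ℚ.≤-Reasoning

  Prob-true : ∀ m → Prob q {m} (λ _ → true) ≡ 1ℚ
  Prob-true zero    = refl
  Prob-true (suc m) = trans (average _) (Prob-true m)

  Prob-false : ∀ m → Prob q {m} (λ _ → false) ≡ 0ℚ
  Prob-false zero    = refl
  Prob-false (suc m) = trans (average _) (Prob-false m)

  Prob-mono : ∀ {m} {B C : Subset m → Bool} → (∀ S → T (B S) → T (C S)) → Prob q B ℚ.≤ Prob q C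
  Prob-mono {zero} {B} {C} B⇒C with B [] | C [] | B⇒C []
  ... | true  | true  | _ = ℚ.≤-refl
  ... | true  | false | f = contradiction _ f
  ... | false | true  | _ = ℚ.nonNegative⁻¹ 1ℚ
  ... | false | false | _ = ℚ.≤-refl
  Prob-mono {suc m} B⇒C =
    average-mono (Prob-mono (λ S → B⇒C (inside ∷ S))) (Prob-mono (λ S → B⇒C (outside ∷ S)))

  0≤Prob : ∀ {m} (B : Subset m → Bool) → 0ℚ ℚ.≤ Prob q B
  0≤Prob {m} B = subst (ℚ._≤ Prob q B) (Prob-false m) (Prob-mono {B = λ _ → false} {B} λ _ ())

  Prob≤1 : ∀ {m} (B : Subset m → Bool) → Prob q B ℚ.≤ 1ℚ
  Prob≤1 {m} B = subst (Prob q B ℚ.≤_) (Prob-true m) (Prob-mono {B = B} {λ _ → true} _)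

  -- Independence: a coordinate in `M` contributes a factor `r`, and one outside averages out.
  Prob-misses : ∀ {m} (M : Subset m) → Prob q (misses M) ≡ r ^ ∣ M ∣
  Prob-misses []                    = refl
  Prob-misses {suc m} (inside  ∷ M) = begin
    q ℚ.* Prob q {m} (λ _ → false) ℚ.+ r ℚ.* Prob q (misses M)
      ≡⟨ cong₂ (λ x y → q ℚ.* x ℚ.+ r ℚ.* y) (Prob-false m) (Prob-misses M) ⟩
    q ℚ.* 0ℚ ℚ.+ r ℚ.* r ^ ∣ M ∣
      ≡⟨ cong (ℚ._+ r ℚ.* r ^ ∣ M ∣) (ℚ.*-zeroʳ q) ⟩
    0ℚ ℚ.+ r ℚ.* r ^ ∣ M ∣
      ≡⟨ ℚ.+-identityˡ _ ⟩
    r ℚ.* r ^ ∣ M ∣ ∎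
    where open ≡-Reasoning
  Prob-misses (outside ∷ M) = trans (average _) (Prob-misses M)

  Prob-∖ : ∀ {m} (B C : Subset m → Bool) →
    Prob q C ℚ.≤ Prob q (λ S → not (B S) ∧ C S) ℚ.+ Prob q B
  Prob-∖ {zero} B C with B [] | C []
  ... | true  | true  = ℚ.≤-refl
  ... | true  | false = ℚ.nonNegative⁻¹ 1ℚ
  ... | false | true  = ℚ.≤-refl
  ... | false | false = ℚ.≤-refl
  Prob-∖ {suc m} B C = ℚ.≤-trans
    (average-mono (Prob-∖ (λ S → B (inside ∷ S)) _) (Prob-∖ (λ S → B (outside ∷ S)) _))
    (ℚ.≤-reflexive (solve 6 (λ q r a b c d →
       q :* (a :+ b) :+ r :* (c :+ d) := (q :* a :+ r :* c) :+ (q :* b :+ r :* d)) refl q r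
       _ (Prob q (λ S → B (inside ∷ S))) _ (Prob q (λ S → B (outside ∷ S)))))
    where open ℚ-Solver

  -- The union bound, by induction on the list: by `Prob-∖` each further mask costs at most the
  -- probability `t` of missing it.
  Prob-hitsAll : ∀ {m} t (Ms : List (Subset m)) → All (λ M → r ^ ∣ M ∣ ℚ.≤ t) Ms →
    1ℚ ℚ.≤ Prob q (hitsAll Ms) ℚ.+ ι (length Ms) ℚ.* t
  Prob-hitsAll {m} t [] [] = ℚ.≤-reflexive (begin
    1ℚ                                   ≡⟨ Prob-true m ⟨
    Prob q {m} (λ _ → true)              ≡⟨ ℚ.+-identityʳ _ ⟨
    Prob q {m} (λ _ → true) ℚ.+ 0ℚ       ≡⟨ cong (Prob q {m} (λ _ → true) ℚ.+_) (ℚ.*-zeroˡ t) ⟨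
    Prob q {m} (λ _ → true) ℚ.+ 0ℚ ℚ.* t ∎)
    where open ≡-Reasoning
  Prob-hitsAll t (M ∷ Ms) (M≤t ∷ Ms≤t) = begin
    1ℚ
      ≤⟨ Prob-hitsAll t Ms Ms≤t ⟩
    Prob q (hitsAll Ms) ℚ.+ k ℚ.* t
      ≤⟨ ℚ.+-monoˡ-≤ (k ℚ.* t) (Prob-∖ (misses M) (hitsAll Ms)) ⟩
    (x ℚ.+ Prob q (misses M)) ℚ.+ k ℚ.* t
      ≤⟨ ℚ.+-monoˡ-≤ (k ℚ.* t) (ℚ.+-monoʳ-≤ x (ℚ.≤-trans (ℚ.≤-reflexive (Prob-misses M)) M≤t)) ⟩
    (x ℚ.+ t) ℚ.+ k ℚ.* t
      ≡⟨ solve 3 (λ x t k → (x :+ t) :+ k :* t := x :+ (con 1ℚ :+ k) :* t) refl x t k ⟩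
    x ℚ.+ (1ℚ ℚ.+ k) ℚ.* t
      ≡⟨ cong (λ y → x ℚ.+ y ℚ.* t) (ι-+ 1 (length Ms)) ⟨
    x ℚ.+ ι (suc (length Ms)) ℚ.* t ∎
    where
    open ℚ.≤-Reasoning
    open ℚ-Solver
    k = ι (length Ms)
    x = Prob q (hitsAll (M ∷ Ms))

  -- The estimate (1 - q)^m ≤ 1/(1 + mq), cleared of its denominator. The induction step uses (1 -
  -- q)(1 + (m + 1)q) = (1 + mq) - (m + 1)q².
  bernoulli : ∀ m → r ^ m ℚ.* (1ℚ ℚ.+ ι m ℚ.* q) ℚ.≤ 1ℚ
  bernoulli zero    = ℚ.≤-reflexive (trans (ℚ.*-identityˡ _)
    (trans (cong (1ℚ ℚ.+_) (ℚ.*-zeroˡ q)) (ℚ.+-identityʳ 1ℚ)))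
  bernoulli (suc m) = begin
    r ^ suc m ℚ.* (1ℚ ℚ.+ ι (suc m) ℚ.* q)
      ≡⟨ cong (λ x → r ^ suc m ℚ.* (1ℚ ℚ.+ x ℚ.* q)) (ι-+ 1 m) ⟩
    r ^ suc m ℚ.* (1ℚ ℚ.+ (1ℚ ℚ.+ ι m) ℚ.* q)
      ≡⟨ rearrange q (ι m) (r ^ m) ⟩
    r ^ m ℚ.* (1ℚ ℚ.+ ι m ℚ.* q) ℚ.+ ℚ.- (r ^ m ℚ.* ((1ℚ ℚ.+ ι m) ℚ.* (q ℚ.* q)))
      ≤⟨ ℚ.+-mono-≤ (bernoulli m) (ℚ.neg-antimono-≤ (0≤* (0≤^ m 0≤r) (0≤* 0≤1+m (0≤* 0≤q 0≤q)))) ⟩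
    1ℚ ℚ.+ ℚ.- 0ℚ
      ≡⟨ ℚ.+-identityʳ 1ℚ ⟩
    1ℚ ∎
    where
    open ℚ.≤-Reasoning
    0≤1+m : 0ℚ ℚ.≤ 1ℚ ℚ.+ ι m
    0≤1+m = subst (0ℚ ℚ.≤_) (ι-+ 1 m) (0≤ι (suc m))
    rearrange : ∀ q m x → ((1ℚ ℚ.- q) ℚ.* x) ℚ.* (1ℚ ℚ.+ (1ℚ ℚ.+ m) ℚ.* q) ≡
      x ℚ.* (1ℚ ℚ.+ m ℚ.* q) ℚ.+ ℚ.- (x ℚ.* ((1ℚ ℚ.+ m) ℚ.* (q ℚ.* q)))
    rearrange = solve 3 (λ q m x → ((con 1ℚ :- q) :* x) :* (con 1ℚ :+ (con 1ℚ :+ m) :* q) :=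
      x :* (con 1ℚ :+ m :* q) :+ :- (x :* ((con 1ℚ :+ m) :* (q :* q)))) refl
      where open ℚ-Solver

  -- m q ≥ K makes (1 - q)^m at most 1/K.
  r^m²-bound : ∀ {K m} → ι K ℚ.≤ ι m ℚ.* q → r ^ (m ℕ.* m) ℚ.* ι (K ℕ.^ m) ℚ.≤ 1ℚ
  r^m²-bound {K} {m} K≤mq = begin
    r ^ (m ℕ.* m) ℚ.* ι (K ℕ.^ m)  ≡⟨ cong₂ ℚ._*_ (sym (^-assocʳ r m m)) (ι-^ K m) ⟩
    (r ^ m) ^ m ℚ.* ι K ^ m        ≡⟨ ^-distrib-* (r ^ m) (ι K) m ⟨
    (r ^ m ℚ.* ι K) ^ m            ≤⟨ ^≤1 m (0≤* (0≤^ m 0≤r) (0≤ι K)) r^mK≤1 ⟩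
    1ℚ                             ∎
    where
    open ℚ.≤-Reasoning
    r^mK≤1 : r ^ m ℚ.* ι K ℚ.≤ 1ℚ
    r^mK≤1 = begin
      r ^ m ℚ.* ι K                  ≤⟨ *-monoˡ (0≤^ m 0≤r) K≤mq ⟩
      r ^ m ℚ.* (ι m ℚ.* q)          ≡⟨ cong (r ^ m ℚ.*_) (ℚ.+-identityˡ (ι m ℚ.* q)) ⟨
      r ^ m ℚ.* (0ℚ ℚ.+ ι m ℚ.* q)   ≤⟨ *-monoˡ (0≤^ m 0≤r) (ℚ.+-monoˡ-≤ (ι m ℚ.* q) (ℚ.nonNegative⁻¹ 1ℚ)) ⟩
      r ^ m ℚ.* (1ℚ ℚ.+ ι m ℚ.* q)   ≤⟨ bernoulli m ⟩
      1ℚ                             ∎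

-- Perturbation of the parameter.

-- The coefficients q and 1 - q have absolute values at most 2 and 1, so each
-- coordinate multiplies the error by at most 3 and adds at most δ.
Prob-lipschitz : ∀ {q q′ δ} → 0ℚ ℚ.≤ q′ → q′ ℚ.≤ 1ℚ → ℚ.∣ q ∣ ℚ.≤ ι 2 → ℚ.∣ 1ℚ ℚ.- q ∣ ℚ.≤ 1ℚ →
  ℚ.∣ q ℚ.- q′ ∣ ℚ.≤ δ → ∀ {m} (B : Subset m → Bool) →
  ℚ.∣ Prob q B ℚ.- Prob q′ B ∣ ℚ.≤ ι (4 ℕ.^ m) ℚ.* δ
Prob-lipschitz {q} {q′} {δ} 0≤q′ q′≤1 q≤2 r≤1 q-q′ = go
  where
  open ℚ.≤-Reasoning
  open Bernoulli 0≤q′ q′≤1 using (Prob-mono; 0≤Prob; Prob≤1)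
  0≤δ : 0ℚ ℚ.≤ δ
  0≤δ = ℚ.≤-trans (ℚ.0≤∣p∣ (q ℚ.- q′)) q-q′

  *-bound : ∀ {a b x y} → ℚ.∣ a ∣ ℚ.≤ x → ℚ.∣ b ∣ ℚ.≤ y → ℚ.∣ a ℚ.* b ∣ ℚ.≤ x ℚ.* y
  *-bound {a} {b} {x} {y} a≤x b≤y = begin
    ℚ.∣ a ℚ.* b ∣       ≡⟨ ℚ.∣p*q∣≡∣p∣*∣q∣ a b ⟩
    ℚ.∣ a ∣ ℚ.* ℚ.∣ b ∣ ≤⟨ *-monoʳ (ℚ.0≤∣p∣ b) a≤x ⟩
    x ℚ.* ℚ.∣ b ∣       ≤⟨ *-monoˡ (ℚ.≤-trans (ℚ.0≤∣p∣ a) a≤x) b≤y ⟩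
    x ℚ.* y             ∎

  -- The coefficients at `q` multiply the inductive errors, while `q - q′` multiplies a difference
  -- of probabilities at `q′`. Since `q′` lies in [0,1], that difference is at most 1 in absolute
  -- value.
  rearrange : ∀ q q′ a b a′ b′ →
    (q ℚ.* a ℚ.+ (1ℚ ℚ.- q) ℚ.* b) ℚ.- (q′ ℚ.* a′ ℚ.+ (1ℚ ℚ.- q′) ℚ.* b′) ≡
    (q ℚ.* (a ℚ.- a′) ℚ.+ (1ℚ ℚ.- q) ℚ.* (b ℚ.- b′)) ℚ.+ (q ℚ.- q′) ℚ.* (a′ ℚ.- b′)
  rearrange = solve 6 (λ q q′ a b a′ b′ →
    (q :* a :+ (con 1ℚ :- q) :* b) :- (q′ :* a′ :+ (con 1ℚ :- q′) :* b′) :=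
    (q :* (a :- a′) :+ (con 1ℚ :- q) :* (b :- b′)) :+ (q :- q′) :* (a′ :- b′)) refl
    where open ℚ-Solver

  ∣a-b∣≤1 : ∀ {a b} → 0ℚ ℚ.≤ a → a ℚ.≤ 1ℚ → 0ℚ ℚ.≤ b → b ℚ.≤ 1ℚ → ℚ.∣ a ℚ.- b ∣ ℚ.≤ 1ℚ
  ∣a-b∣≤1 {a} {b} 0≤a a≤1 0≤b b≤1 = ∣p∣≤q (a ℚ.- b) (difference a≤1 0≤b)
    (subst (ℚ._≤ 1ℚ) (solve 2 (λ a b → b :- a := :- (a :- b)) refl a b) (difference b≤1 0≤a))
    where
    open ℚ-Solver
    difference : ∀ {a b} → a ℚ.≤ 1ℚ → 0ℚ ℚ.≤ b → a ℚ.- b ℚ.≤ 1ℚ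
    difference {a} {b} a≤1 0≤b = begin
      a ℚ.- b            ≤⟨ ℚ.+-mono-≤ a≤1 (ℚ.neg-antimono-≤ 0≤b) ⟩
      1ℚ ℚ.- 0ℚ          ≡⟨ ℚ.+-identityʳ 1ℚ ⟩
      1ℚ                 ∎

  go : ∀ {m} (B : Subset m → Bool) → ℚ.∣ Prob q B ℚ.- Prob q′ B ∣ ℚ.≤ ι (4 ℕ.^ m) ℚ.* δ
  go {zero} B = begin
    ℚ.∣ (if B [] then 1ℚ else 0ℚ) ℚ.- (if B [] then 1ℚ else 0ℚ) ∣
      ≡⟨ cong ℚ.∣_∣ (ℚ.+-inverseʳ (if B [] then 1ℚ else 0ℚ)) ⟩
    0ℚ           ≤⟨ 0≤δ ⟩
    δ            ≡⟨ ℚ.*-identityˡ δ ⟨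
    ι 1 ℚ.* δ    ∎
  go {suc m} B = begin
    ℚ.∣ Prob q B ℚ.- Prob q′ B ∣
      ≡⟨ cong ℚ.∣_∣ (rearrange q q′ a b a′ b′) ⟩
    ℚ.∣ (q ℚ.* (a ℚ.- a′) ℚ.+ (1ℚ ℚ.- q) ℚ.* (b ℚ.- b′)) ℚ.+ (q ℚ.- q′) ℚ.* (a′ ℚ.- b′) ∣
      ≤⟨ ℚ.∣p+q∣≤∣p∣+∣q∣ (q ℚ.* (a ℚ.- a′) ℚ.+ (1ℚ ℚ.- q) ℚ.* (b ℚ.- b′)) _ ⟩
    ℚ.∣ q ℚ.* (a ℚ.- a′) ℚ.+ (1ℚ ℚ.- q) ℚ.* (b ℚ.- b′) ∣ ℚ.+ ℚ.∣ (q ℚ.- q′) ℚ.* (a′ ℚ.- b′) ∣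
      ≤⟨ ℚ.+-mono-≤ (ℚ.∣p+q∣≤∣p∣+∣q∣ (q ℚ.* (a ℚ.- a′)) _)
           (*-bound q-q′ (∣a-b∣≤1 (0≤Prob B₁) (Prob≤1 B₁) (0≤Prob B₀) (Prob≤1 B₀))) ⟩
    (ℚ.∣ q ℚ.* (a ℚ.- a′) ∣ ℚ.+ ℚ.∣ (1ℚ ℚ.- q) ℚ.* (b ℚ.- b′) ∣) ℚ.+ δ ℚ.* 1ℚ
      ≤⟨ ℚ.+-mono-≤ (ℚ.+-mono-≤ (*-bound q≤2 (go B₁)) (*-bound r≤1 (go B₀))) δ≤ ⟩
    (ι 2 ℚ.* D ℚ.+ 1ℚ ℚ.* D) ℚ.+ D
      ≡⟨ solve 1 (λ D → (con (ι 2) :* D :+ con 1ℚ :* D) :+ D := con (ι 4) :* D) refl D ⟩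
    ι 4 ℚ.* (ι (4 ℕ.^ m) ℚ.* δ)
      ≡⟨ ℚ.*-assoc (ι 4) (ι (4 ℕ.^ m)) δ ⟨
    (ι 4 ℚ.* ι (4 ℕ.^ m)) ℚ.* δ
      ≡⟨ cong (ℚ._* δ) (ι-* 4 (4 ℕ.^ m)) ⟨
    ι (4 ℕ.^ suc m) ℚ.* δ ∎
    where
    open ℚ-Solver
    B₁ B₀ : Subset m → Bool
    B₁ S = B (inside ∷ S)
    B₀ S = B (outside ∷ S)
    a = Prob q B₁
    b = Prob q B₀
    a′ = Prob q′ B₁
    b′ = Prob q′ B₀
    D = ι (4 ℕ.^ m) ℚ.* δ
    δ≤ : δ ℚ.* 1ℚ ℚ.≤ D
    δ≤ = begin
      δ ℚ.* 1ℚ    ≡⟨ ℚ.*-comm δ 1ℚ ⟩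
      1ℚ ℚ.* δ    ≤⟨ *-monoʳ 0≤δ (ι-mono-≤ (ℕ.m^n>0 4 m)) ⟩
      D           ∎

-- The rational approximations of a real p ≤ 1 may exceed 1.
clamp : ∀ {q x δ} → x ℚ.≤ q → x ℚ.≤ 1ℚ → q ℚ.≤ 1ℚ ℚ.+ δ → 0ℚ ℚ.≤ δ →
  ∃[ q′ ] x ℚ.≤ q′ × q′ ℚ.≤ 1ℚ × ℚ.∣ q ℚ.- q′ ∣ ℚ.≤ δ
clamp {q} {x} {δ} x≤q x≤1 q≤1+δ 0≤δ with ℚ.≤-total q 1ℚ
... | inj₁ q≤1 = q , x≤q , q≤1 , subst (ℚ._≤ δ) (sym (cong ℚ.∣_∣ (ℚ.+-inverseʳ q))) 0≤δ
... | inj₂ 1≤q = 1ℚ , x≤1 , ℚ.≤-refl , (begin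
  ℚ.∣ q ℚ.- 1ℚ ∣        ≡⟨ ℚ.0≤p⇒∣p∣≡p (p≤q⇒0≤q-p 1≤q) ⟩
  q ℚ.- 1ℚ              ≤⟨ ℚ.+-monoˡ-≤ (ℚ.- 1ℚ) q≤1+δ ⟩
  (1ℚ ℚ.+ δ) ℚ.- 1ℚ     ≡⟨ solve 1 (λ δ → (con 1ℚ :+ δ) :- con 1ℚ := δ) refl δ ⟩
  δ                     ∎)
  where
  open ℚ.≤-Reasoning
  open ℚ-Solver

-- The union bound over all pairs of vertex sets, and its transfer between parameters.

-- At most 4^n masks are each missed with probability at most K^(-m) ≤ 8^(-n), so the failure
-- probability is at most 2^(-n) ≤ `η`.
Prob-hitsAll-8ⁿ : ∀ {q η n m K e} {Ms : List (Subset e)} → 0ℚ ℚ.≤ q → q ℚ.≤ 1ℚ →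
  ι K ℚ.≤ ι m ℚ.* q → 8 ℕ.^ n ℕ.≤ K ℕ.^ m → 1ℚ ℚ.≤ ι (2 ℕ.^ n) ℚ.* η → 0ℚ ℚ.≤ η →
  length Ms ℕ.≤ 2 ℕ.^ n ℕ.* 2 ℕ.^ n → All (λ M → m ℕ.* m ℕ.≤ ∣ M ∣) Ms →
  1ℚ ℚ.≤ Prob q (hitsAll Ms) ℚ.+ η
Prob-hitsAll-8ⁿ {q} {η} {n} {m} {K} {Ms = Ms} 0≤q q≤1 K≤mq 8ⁿ≤Kᵐ 1≤2ⁿη 0≤η Ms≤4ⁿ m²≤Ms = begin
  1ℚ
    ≤⟨ Prob-hitsAll t Ms (All.map (^-antimono 0≤r r≤1) m²≤Ms) ⟩
  Prob q (hitsAll Ms) ℚ.+ ι (length Ms) ℚ.* t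
    ≤⟨ ℚ.+-monoʳ-≤ (Prob q (hitsAll Ms)) bound ⟩
  Prob q (hitsAll Ms) ℚ.+ η ∎
  where
  open ℚ.≤-Reasoning
  open Bernoulli 0≤q q≤1
  t x : ℚ
  t = r ^ (m ℕ.* m)
  x = ι (2 ℕ.^ n)
  0≤t : 0ℚ ℚ.≤ t
  0≤t = 0≤^ (m ℕ.* m) 0≤r
  xxx≡8ⁿ : x ℚ.* x ℚ.* x ≡ ι (8 ℕ.^ n)
  xxx≡8ⁿ = begin-equality
    x ℚ.* x ℚ.* x                            ≡⟨ ℚ.*-assoc x x x ⟩
    x ℚ.* (x ℚ.* x)                          ≡⟨ cong (λ y → y ℚ.* (y ℚ.* y)) (ι-^ 2 n) ⟩
    ι 2 ^ n ℚ.* (ι 2 ^ n ℚ.* ι 2 ^ n)        ≡⟨ cong (ι 2 ^ n ℚ.*_) (^-distrib-* (ι 2) (ι 2) n) ⟨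
    ι 2 ^ n ℚ.* (ι 2 ℚ.* ι 2) ^ n            ≡⟨ ^-distrib-* (ι 2) (ι 2 ℚ.* ι 2) n ⟨
    ι 8 ^ n                                  ≡⟨ ι-^ 8 n ⟨
    ι (8 ℕ.^ n)                              ∎
  bound : ι (length Ms) ℚ.* t ℚ.≤ η
  bound = begin
    ι (length Ms) ℚ.* t
      ≤⟨ *-monoʳ 0≤t (ι-mono-≤ Ms≤4ⁿ) ⟩
    ι (2 ℕ.^ n ℕ.* 2 ℕ.^ n) ℚ.* t
      ≡⟨ cong (ℚ._* t) (ι-* (2 ℕ.^ n) (2 ℕ.^ n)) ⟩
    x ℚ.* x ℚ.* t
      ≡⟨ ℚ.*-identityʳ _ ⟨
    x ℚ.* x ℚ.* t ℚ.* 1ℚ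
      -- The factor 2^n `η` ≥ 1 supplies the third 2^n, completing 8^n without any division.
      ≤⟨ *-monoˡ (0≤* (0≤* (0≤ι (2 ℕ.^ n)) (0≤ι (2 ℕ.^ n))) 0≤t) 1≤2ⁿη ⟩
    x ℚ.* x ℚ.* t ℚ.* (x ℚ.* η)
      ≡⟨ solve 3 (λ x t η → x :* x :* t :* (x :* η) := t :* (x :* x :* x) :* η) refl x t η ⟩
    t ℚ.* (x ℚ.* x ℚ.* x) ℚ.* η
      ≡⟨ cong (λ y → t ℚ.* y ℚ.* η) xxx≡8ⁿ ⟩
    t ℚ.* ι (8 ℕ.^ n) ℚ.* η
      ≤⟨ *-monoʳ 0≤η (*-monoˡ 0≤t (ι-mono-≤ 8ⁿ≤Kᵐ)) ⟩
    t ℚ.* ι (K ℕ.^ m) ℚ.* η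
      ≤⟨ *-monoʳ 0≤η (r^m²-bound {K} {m} K≤mq) ⟩
    1ℚ ℚ.* η
      ≡⟨ ℚ.*-identityˡ η ⟩
    η ∎
    where open ℚ-Solver

-- The second `η` pays for passing from `q′` to `q`. The range 0 ≤ `q` ≤ 2 provides the coefficient
-- bounds that `Prob-lipschitz` asks for.
Prob-perturb : ∀ {q q′ δ η} → 0ℚ ℚ.≤ q′ → q′ ℚ.≤ 1ℚ → 0ℚ ℚ.≤ q → q ℚ.≤ 1ℚ ℚ.+ 1ℚ →
  ℚ.∣ q ℚ.- q′ ∣ ℚ.≤ δ → ∀ {m} (B : Subset m → Bool) → ι (4 ℕ.^ m) ℚ.* δ ℚ.≤ η →
  1ℚ ℚ.≤ Prob q′ B ℚ.+ η → 1ℚ ℚ.≤ Prob q B ℚ.+ (η ℚ.+ η)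
Prob-perturb {q} {q′} {δ} {η} 0≤q′ q′≤1 0≤q q≤2 q-q′ B 4ᵐδ≤η 1≤ = begin
  1ℚ
    ≤⟨ 1≤ ⟩
  Prob q′ B ℚ.+ η
    ≡⟨ solve 3 (λ P P′ η → P′ :+ η := (P :+ η) :+ (:- (P :- P′))) refl (Prob q B) (Prob q′ B) η ⟩
  (Prob q B ℚ.+ η) ℚ.+ ℚ.- (Prob q B ℚ.- Prob q′ B)
    ≤⟨ ℚ.+-monoʳ-≤ (Prob q B ℚ.+ η) (ℚ.≤-trans (-p≤∣p∣ (Prob q B ℚ.- Prob q′ B))
         (ℚ.≤-trans (Prob-lipschitz 0≤q′ q′≤1 ∣q∣≤2 ∣r∣≤1 q-q′ B) 4ᵐδ≤η)) ⟩
  (Prob q B ℚ.+ η) ℚ.+ η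
    ≡⟨ ℚ.+-assoc (Prob q B) η η ⟩
  Prob q B ℚ.+ (η ℚ.+ η) ∎
  where
  open ℚ.≤-Reasoning
  open ℚ-Solver
  ∣q∣≤2 : ℚ.∣ q ∣ ℚ.≤ ι 2
  ∣q∣≤2 = ∣p∣≤q q q≤2 (ℚ.≤-trans (ℚ.neg-antimono-≤ 0≤q) (0≤ι 2))
  ∣r∣≤1 : ℚ.∣ 1ℚ ℚ.- q ∣ ℚ.≤ 1ℚ
  ∣r∣≤1 = ∣p∣≤q (1ℚ ℚ.- q)
    (ℚ.+-monoʳ-≤ 1ℚ (ℚ.neg-antimono-≤ 0≤q))
    (begin
      ℚ.- (1ℚ ℚ.- q)        ≡⟨ solve 1 (λ q → :- (con 1ℚ :- q) := q :- con 1ℚ) refl q ⟩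
      q ℚ.- 1ℚ              ≤⟨ ℚ.+-monoˡ-≤ (ℚ.- 1ℚ) q≤2 ⟩
      (1ℚ ℚ.+ 1ℚ) ℚ.- 1ℚ    ≡⟨⟩
      1ℚ                    ∎)
  -p≤∣p∣ : ∀ p → ℚ.- p ℚ.≤ ℚ.∣ p ∣
  -p≤∣p∣ p with ℚ.≤-total 0ℚ p
  ... | inj₁ 0≤p = ℚ.≤-trans (ℚ.neg-antimono-≤ 0≤p) (ℚ.0≤∣p∣ p)
  ... | inj₂ p≤0 = ℚ.≤-reflexive (trans (sym (ℚ.0≤p⇒∣p∣≡p (ℚ.neg-antimono-≤ p≤0))) (ℚ.∣-p∣≡∣p∣ p))

-- Enumeration of subsets, and the room left by the cops.

length-subsets : ∀ n → length (subsets n) ≡ 2 ℕ.^ n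
length-subsets zero    = refl
length-subsets (suc n) = begin
  length (map (inside ∷_) (subsets n) ++ map (outside ∷_) (subsets n))
    ≡⟨ List.length-++ (map (inside ∷_) (subsets n)) ⟩
  length (map (inside ∷_) (subsets n)) ℕ.+ length (map (outside ∷_) (subsets n))
    ≡⟨ cong₂ ℕ._+_ (List.length-map (inside ∷_) (subsets n)) (List.length-map (outside ∷_) (subsets n)) ⟩
  length (subsets n) ℕ.+ length (subsets n)
    ≡⟨ cong (λ k → k ℕ.+ k) (length-subsets n) ⟩
  2 ℕ.^ n ℕ.+ 2 ℕ.^ n
    ≡⟨ cong (2 ℕ.^ n ℕ.+_) (ℕ.+-identityʳ (2 ℕ.^ n)) ⟨
  2 ℕ.^ suc n ∎
  where open ≡-Reasoning

∈-subsets : ∀ {n} (S : Subset n) → S List.∈ subsets n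
∈-subsets []            = here refl
∈-subsets (inside  ∷ S) = List.∈-++⁺ˡ (List.∈-map⁺ (inside ∷_) (∈-subsets S))
∈-subsets (outside ∷ S) = List.∈-++⁺ʳ (map (inside ∷_) (subsets _)) (List.∈-map⁺ (outside ∷_) (∈-subsets S))

length-cartesianProduct : ∀ {A B : Set} (xs : List A) (ys : List B) →
  length (cartesianProduct xs ys) ≡ length xs ℕ.* length ys
length-cartesianProduct []       ys = refl
length-cartesianProduct (x ∷ xs) ys = trans (List.length-++ (map (x ,_) ys))
  (cong₂ ℕ._+_ (List.length-map (x ,_) ys) (length-cartesianProduct xs ys))

-- This is k + n/D ≤ n with D = `suc d`, cleared of the denominator. Of the two `ε` below 1, one
-- absorbs the error in comparing k with αn, as `ε` ≤ `ε` n, and the other yields n/D, as D `ε` ≥ 1.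
room : ∀ {α ε d n k} → α ℚ.+ (ε ℚ.+ ε) ℚ.≤ 1ℚ → 0ℚ ℚ.≤ ε → 1ℚ ℚ.≤ ι (suc d) ℚ.* ε → 1 ℕ.≤ n →
  ι k ℚ.≤ α ℚ.* ι n ℚ.+ ε → suc d ℕ.* k ℕ.+ n ℕ.≤ suc d ℕ.* n
room {α} {ε} {d} {n} {k} α+2ε≤1 0≤ε 1≤dε 1≤n k≤αn+ε = ι-cancel-≤ (begin
  ι (suc d ℕ.* k ℕ.+ n)                      ≡⟨ ι-+ (suc d ℕ.* k) n ⟩
  ι (suc d ℕ.* k) ℚ.+ ι n                    ≡⟨ cong₂ ℚ._+_ (ι-* (suc d) k) (sym (ℚ.*-identityˡ (ι n))) ⟩
  D ℚ.* ι k ℚ.+ 1ℚ ℚ.* ι n                   ≤⟨ ℚ.+-mono-≤ (*-monoˡ (0≤ι (suc d)) k≤) (*-monoʳ (0≤ι n) 1≤dε) ⟩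
  D ℚ.* (α ℚ.* ι n ℚ.+ ε ℚ.* ι n) ℚ.+ (D ℚ.* ε) ℚ.* ι n
    ≡⟨ solve 4 (λ D α ε n →
         D :* (α :* n :+ ε :* n) :+ (D :* ε) :* n := D :* ((α :+ (ε :+ ε)) :* n)) refl D α ε (ι n) ⟩
  D ℚ.* ((α ℚ.+ (ε ℚ.+ ε)) ℚ.* ι n)          ≤⟨ *-monoˡ (0≤ι (suc d)) (*-monoʳ (0≤ι n) α+2ε≤1) ⟩
  D ℚ.* (1ℚ ℚ.* ι n)                         ≡⟨ cong (D ℚ.*_) (ℚ.*-identityˡ (ι n)) ⟩
  D ℚ.* ι n                                  ≡⟨ ι-* (suc d) n ⟨
  ι (suc d ℕ.* n)                            ∎)
  where
  open ℚ.≤-Reasoning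
  open ℚ-Solver
  D : ℚ
  D = ι (suc d)
  k≤ : ι k ℚ.≤ α ℚ.* ι n ℚ.+ ε ℚ.* ι n
  k≤ = begin
    ι k                            ≤⟨ k≤αn+ε ⟩
    α ℚ.* ι n ℚ.+ ε                ≡⟨ cong (α ℚ.* ι n ℚ.+_) (ℚ.*-identityʳ ε) ⟨
    α ℚ.* ι n ℚ.+ ε ℚ.* 1ℚ         ≤⟨ ℚ.+-monoʳ-≤ (α ℚ.* ι n) (*-monoˡ 0≤ε (ι-mono-≤ 1≤n)) ⟩
    α ℚ.* ι n ℚ.+ ε ℚ.* ι n        ∎

n≤2^n : ∀ n → n ℕ.≤ 2 ℕ.^ n
n≤2^n zero    = z≤n
n≤2^n (suc n) = ℕ.+-mono-≤ (ℕ.m^n>0 2 n)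
  (ℕ.≤-trans (n≤2^n n) (ℕ.≤-reflexive (sym (ℕ.+-identityʳ (2 ℕ.^ n)))))

-- The threshold theorem for both random graph models at once.

-- crossings A B marks the pairs whose presence gives an arc from A to B.
module RandomGraph
  (pairs : ∀ n → List (Fin n × Fin n))
  (E : ∀ n → Subset (length (pairs n)) → Rel (Fin n) 0ℓ)
  (E? : ∀ n G → Decidable (E n G))
  (crossings : ∀ {n} → Subset n → Subset n → Fin n × Fin n → Bool)
  (∣crossings∣ : ∀ {n} (A B : Subset n) → (∀ {x} → x ∈ A → x ∉ B) →
    ∣ A ∣ ℕ.* ∣ B ∣ ℕ.≤ ∣ indices (crossings A B) (pairs n) ∣)
  (crossings⁻ : ∀ {n G e} (A B : Subset n) → e ∈ G →
    crossings A B (List.lookup (pairs n) e) ≡ true → ∃₂ λ u v → u ∈ A × v ∈ B × E n G u v)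
  where

  module _ (n : ℕ) where

    mask : Subset n × Subset n → Subset (length (pairs n))
    mask (A , B) = indices (crossings A B) (pairs n)

    -- Masks are selected by their cardinality alone, which is all that the union bound uses.
    masks : ℕ → List (Subset (length (pairs n)))
    masks t = filter (λ M → t ℕ.≤? ∣ M ∣) (map mask (cartesianProduct (subsets n) (subsets n)))

    length-masks : ∀ t → length (masks t) ℕ.≤ 2 ℕ.^ n ℕ.* 2 ℕ.^ n
    length-masks t = begin
      length (masks t)
        ≤⟨ List.length-filter (λ M → t ℕ.≤? ∣ M ∣) (map mask (cartesianProduct (subsets n) (subsets n))) ⟩
      length (map mask (cartesianProduct (subsets n) (subsets n)))
        ≡⟨ List.length-map mask (cartesianProduct (subsets n) (subsets n)) ⟩
      length (cartesianProduct (subsets n) (subsets n))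
        ≡⟨ length-cartesianProduct (subsets n) (subsets n) ⟩
      length (subsets n) ℕ.* length (subsets n)
        ≡⟨ cong (λ k → k ℕ.* k) (length-subsets n) ⟩
      2 ℕ.^ n ℕ.* 2 ℕ.^ n ∎
      where open ℕ.≤-Reasoning

    masks-large : ∀ t → All (λ M → t ℕ.≤ ∣ M ∣) (masks t)
    masks-large t = All.all-filter (λ M → t ℕ.≤? ∣ M ∣) (map mask (cartesianProduct (subsets n) (subsets n)))

    -- `hitsAll` is the decidable event that stands in for the robber's win. The mask of two
    -- disjoint sets of at least m vertices has at least m² elements, so it is in the list, and an
    -- element it shares with `G` is the required arc.
    hitsAll⇒expands : ∀ m G → T (hitsAll (masks (m ℕ.* m)) G) → Expands (E n G) m
    hitsAll⇒expands m G hit A B disjoint m≤A m≤B =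
      let e , e∈M , e∈G = hits⁻ (mask (A , B)) G
            (All.lookup (All.all⁺ (λ M → hits M G) (masks (m ℕ.* m)) hit) AB∈)
      in crossings⁻ A B e∈G (∈-indices (crossings A B) (pairs n) e∈M)
      where
      AB∈ : mask (A , B) List.∈ masks (m ℕ.* m)
      AB∈ = List.∈-filter⁺ (λ M → m ℕ.* m ℕ.≤? ∣ M ∣)
        (List.∈-map⁺ mask (List.∈-cartesianProduct⁺ (∈-subsets A) (∈-subsets B)))
        (ℕ.≤-trans (ℕ.*-mono-≤ m≤A m≤B) (∣crossings∣ A B disjoint))

  module Threshold (α : ℝ) {ε : ℚ} (0<ε : 0ℚ ℚ.< ε)
    (Nα : ℕ) (α+2ε≤1 : ∀ j → Nα ℕ.≤ j → seq α j ℚ.+ (ε ℚ.+ ε) ℚ.≤ 1ℚ)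
    (d-1 : ℕ) (1≤dε : 1ℚ ℚ.≤ ι (suc d-1) ℚ.* ε) where

    private
      -- With m = `size n` and n ≤ 6dm, the choice of `K` gives K^m = 8^(6dm) ≥ 8^n, and the choice
      -- of `c` gives m · c/n ≥ K.
      d K c : ℕ
      d = suc d-1
      K = 8 ℕ.^ (6 ℕ.* d)
      c = 6 ℕ.* d ℕ.* K

      size : ℕ → ℕ
      size n = n ℕ./ (3 ℕ.* d)

      doNotSuffice : ∀ n G → 3 ℕ.* d ℕ.≤ n → T (hitsAll (masks n (size n ℕ.* size n)) G) →
        DoNotSuffice (E n G) (α * fromℕ n)
      -- From n ≥ 3d the quotient is positive, hence of the form `suc m`.
      doNotSuffice n G 3d≤n hit k k≤αn with size n in eq | ℕ.m≥n⇒m/n>0 {n} {3 ℕ.* d} 3d≤n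
      ... | suc m | _ = Robber.robberEscapes (E n G) (E? n G) {m} (hitsAll⇒expands n (suc m) G hit) enough
        where
        open ℕ.≤-Reasoning
        -- From this index on, both the bound on `α` and the comparison of `k` with αn up to `ε`
        -- hold.
        j = Nα ℕ.⊔ proj₁ (k≤αn ε 0<ε)

        dk+n≤dn : d ℕ.* k ℕ.+ n ℕ.≤ d ℕ.* n
        dk+n≤dn = room {seq α j} {ε} {d-1} {n} {k}
          (α+2ε≤1 j (ℕ.m≤m⊔n Nα _)) (ℚ.<⇒≤ 0<ε) 1≤dε (ℕ.≤-trans (s≤s z≤n) 3d≤n)
          (proj₂ (k≤αn ε 0<ε) j (ℕ.m≤n⊔m Nα _))

        3dm≤n : d ℕ.* (3 ℕ.* suc m) ℕ.≤ n
        3dm≤n = begin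
          d ℕ.* (3 ℕ.* suc m)      ≡⟨ ℕ.*-assoc d 3 (suc m) ⟨
          d ℕ.* 3 ℕ.* suc m        ≡⟨ cong (ℕ._* suc m) (ℕ.*-comm d 3) ⟩
          3 ℕ.* d ℕ.* suc m        ≡⟨ ℕ.*-comm (3 ℕ.* d) (suc m) ⟩
          suc m ℕ.* (3 ℕ.* d)      ≡⟨ cong (ℕ._* (3 ℕ.* d)) eq ⟨
          size n ℕ.* (3 ℕ.* d)     ≤⟨ ℕ.m/n*n≤m n (3 ℕ.* d) ⟩
          n                        ∎

        enough : k ℕ.+ 3 ℕ.* suc m ℕ.≤ n
        enough = ℕ.*-cancelˡ-≤ d (begin
          d ℕ.* (k ℕ.+ 3 ℕ.* suc m)             ≡⟨ ℕ.*-distribˡ-+ d k _ ⟩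
          d ℕ.* k ℕ.+ d ℕ.* (3 ℕ.* suc m)       ≤⟨ ℕ.+-monoʳ-≤ (d ℕ.* k) 3dm≤n ⟩
          d ℕ.* k ℕ.+ n                         ≤⟨ dk+n≤dn ⟩
          d ℕ.* n                               ∎)

      -- The remainder is below 3d, which is at most 3d · `size n` because the quotient is positive.
      n≤6dm : ∀ n → 3 ℕ.* d ℕ.≤ n → n ℕ.≤ 6 ℕ.* d ℕ.* size n
      n≤6dm n 3d≤n = begin
        n                                            ≡⟨ ℕ.m≡m%n+[m/n]*n n (3 ℕ.* d) ⟩
        n ℕ.% (3 ℕ.* d) ℕ.+ size n ℕ.* (3 ℕ.* d)     ≤⟨ ℕ.+-monoˡ-≤ _ (ℕ.<⇒≤ (ℕ.m%n<n n (3 ℕ.* d))) ⟩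
        3 ℕ.* d ℕ.+ size n ℕ.* (3 ℕ.* d)             ≡⟨ cong (ℕ._+ size n ℕ.* (3 ℕ.* d)) (ℕ.*-identityˡ (3 ℕ.* d)) ⟨
        1 ℕ.* (3 ℕ.* d) ℕ.+ size n ℕ.* (3 ℕ.* d)     ≤⟨ ℕ.+-monoˡ-≤ _ (ℕ.*-monoˡ-≤ (3 ℕ.* d) (ℕ.m≥n⇒m/n>0 3d≤n)) ⟩
        size n ℕ.* (3 ℕ.* d) ℕ.+ size n ℕ.* (3 ℕ.* d)
          ≡⟨ solve 2 (λ s d → s :* (con 3 :* d) :+ s :* (con 3 :* d) := con 6 :* d :* s)
               refl (size n) d ⟩
        6 ℕ.* d ℕ.* size n                           ∎
        where
        open ℕ.≤-Reasoning
        open ℕ-Solver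

      8ⁿ≤Kᵐ : ∀ n → 3 ℕ.* d ℕ.≤ n → 8 ℕ.^ n ℕ.≤ K ℕ.^ size n
      8ⁿ≤Kᵐ n 3d≤n = ℕ.≤-trans (ℕ.^-monoʳ-≤ 8 (n≤6dm n 3d≤n))
        (ℕ.≤-reflexive (sym (ℕ.^-*-assoc 8 (6 ℕ.* d) (size n))))

      K≤mq : ∀ n .{{_ : ℕ.NonZero n}} {q} → 3 ℕ.* d ℕ.≤ n → ι c ℚ.* (+ 1 ℚ./ n) ℚ.≤ q →
        ι K ℚ.≤ ι (size n) ℚ.* q
      K≤mq n {q} 3d≤n c/n≤q = begin
        ι K                                 ≡⟨ ℚ.*-identityˡ (ι K) ⟨
        1ℚ ℚ.* ι K                          ≡⟨ cong (ℚ._* ι K) (ι-inverse n) ⟨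
        ι n ℚ.* 1/n ℚ.* ι K                 ≤⟨ *-monoʳ (0≤ι K) (*-monoʳ 0≤1/n (ι-mono-≤ (n≤6dm n 3d≤n))) ⟩
        ι (6 ℕ.* d ℕ.* m) ℚ.* 1/n ℚ.* ι K   ≡⟨ cong (λ x → x ℚ.* 1/n ℚ.* ι K) (ι-* (6 ℕ.* d) m) ⟩
        ι (6 ℕ.* d) ℚ.* ι m ℚ.* 1/n ℚ.* ι K
          ≡⟨ solve 4 (λ a m i k → a :* m :* i :* k := m :* ((a :* k) :* i))
               refl (ι (6 ℕ.* d)) (ι m) 1/n (ι K) ⟩
        ι m ℚ.* ((ι (6 ℕ.* d) ℚ.* ι K) ℚ.* 1/n) ≡⟨ cong (λ x → ι m ℚ.* (x ℚ.* 1/n)) (ι-* (6 ℕ.* d) K) ⟨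
        ι m ℚ.* (ι c ℚ.* 1/n)               ≤⟨ *-monoˡ (0≤ι m) c/n≤q ⟩
        ι m ℚ.* q                           ∎
        where
        open ℚ.≤-Reasoning
        open ℚ-Solver
        m = size n
        1/n = + 1 ℚ./ n
        0≤1/n : 0ℚ ℚ.≤ 1/n
        0≤1/n = ℚ.nonNegative⁻¹ 1/n {{ℚ.normalize-nonNeg 1 n}}

      0<c : 0 ℕ.< c
      0<c = ℕ.*-mono-≤ {1} {6 ℕ.* d} (s≤s z≤n) (ℕ.m^n>0 8 (6 ℕ.* d))

      module _ (n : ℕ) .{{_ : ℕ.NonZero n}} where

        x : ℚ
        x = ι c ℚ.* (+ 1 ℚ./ n)

        0<1/ : ∀ n .{{_ : ℕ.NonZero n}} → 0ℚ ℚ.< + 1 ℚ./ n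
        0<1/ n = ℚ.positive⁻¹ (+ 1 ℚ./ n) {{ℚ.normalize-pos 1 n}}

        0<x : 0ℚ ℚ.< x
        0<x = 0<* (ℚ.<-≤-trans (ℚ.positive⁻¹ 1ℚ) (ι-mono-≤ 0<c)) (0<1/ n)

        x≤1 : c ℕ.≤ n → x ℚ.≤ 1ℚ
        x≤1 c≤n = ℚ.≤-trans (*-monoʳ (ℚ.<⇒≤ (0<1/ n)) (ι-mono-≤ c≤n)) (ℚ.≤-reflexive (ι-inverse n))

        -- A lower bound on a real holds for its approximations only up to a tolerance. The constant
        -- of the theorem is therefore 2c: with tolerance `x` = c/n, the approximations stay above
        -- c/n.
        2x-x≤q : ∀ {q} → ι (c ℕ.+ c) ℚ.* (+ 1 ℚ./ n) ℚ.≤ q ℚ.+ x → x ℚ.≤ q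
        2x-x≤q {q} 2x≤q+x = begin
          x
            ≡⟨ solve 2 (λ c i → c :* i := (c :+ c) :* i :- c :* i) refl (ι c) (+ 1 ℚ./ n) ⟩
          (ι c ℚ.+ ι c) ℚ.* (+ 1 ℚ./ n) ℚ.- x          ≡⟨ cong (λ y → y ℚ.* (+ 1 ℚ./ n) ℚ.- x) (ι-+ c c) ⟨
          ι (c ℕ.+ c) ℚ.* (+ 1 ℚ./ n) ℚ.- x            ≤⟨ ℚ.+-monoˡ-≤ (ℚ.- x) 2x≤q+x ⟩
          (q ℚ.+ x) ℚ.- x                              ≡⟨ solve 2 (λ q x → (q :+ x) :- x := q) refl q x ⟩
          q                                            ∎
          where
          open ℚ.≤-Reasoning
          open ℚ-Solver

        Prob-expands : ∀ {q η δ} → 3 ℕ.* d ℕ.≤ n → c ℕ.≤ n → 0ℚ ℚ.≤ η → 1ℚ ℚ.≤ ι (2 ℕ.^ n) ℚ.* η →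
          0ℚ ℚ.≤ δ → ι (4 ℕ.^ length (pairs n)) ℚ.* δ ℚ.≤ η →
          x ℚ.≤ q → q ℚ.≤ 1ℚ ℚ.+ δ → q ℚ.≤ 1ℚ ℚ.+ 1ℚ →
          1ℚ ℚ.≤ Prob q (hitsAll (masks n (size n ℕ.* size n))) ℚ.+ (η ℚ.+ η)
        Prob-expands {q} {η} {δ} 3d≤n c≤n 0≤η 1≤2ⁿη 0≤δ 4ᵉδ≤η x≤q q≤1+δ q≤2 =
          let q′ , x≤q′ , q′≤1 , q-q′ = clamp {q} x≤q (x≤1 c≤n) q≤1+δ 0≤δ
              0≤q′ = ℚ.≤-trans (ℚ.<⇒≤ 0<x) x≤q′
          in Prob-perturb {q} {q′} 0≤q′ q′≤1 (ℚ.≤-trans (ℚ.<⇒≤ 0<x) x≤q) q≤2 q-q′ B 4ᵉδ≤η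
               (Prob-hitsAll-8ⁿ {q′} {η} {n} {size n} {K} 0≤q′ q′≤1 (K≤mq n 3d≤n x≤q′) (8ⁿ≤Kᵐ n 3d≤n)
                 1≤2ⁿη 0≤η (length-masks n t) (masks-large n t))
          where
          t : ℕ
          t = size n ℕ.* size n
          B : Subset (length (pairs n)) → Bool
          B = hitsAll (masks n t)

        -- Here n is fixed and only the index of approximation grows, so tolerances may depend on n:
        -- `x` keeps the approximations above c/n, `δ` = η/4^e with e the number of pairs makes the
        -- perturbation cost at most `η`, and 1 keeps them below 2.
        eventually : ∀ (p : ℝ) η → 0ℚ ℚ.< η → 3 ℕ.* d ℕ.≤ n → c ℕ.≤ n → 1ℚ ℚ.≤ ι (2 ℕ.^ n) ℚ.* η →
          fromℚ (ι (c ℕ.+ c)) * fromℚ (+ 1 ℚ./ n) ≤ p → p ≤ 1ℝ →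
          ∃[ N ] ∀ j → N ℕ.≤ j →
            1ℚ ℚ.≤ Prob (seq p j) (hitsAll (masks n (size n ℕ.* size n))) ℚ.+ (η ℚ.+ η)
        eventually p η 0<η 3d≤n c≤n 1≤2ⁿη C/n≤p p≤1 =
          let N₁ , h₁ = C/n≤p x 0<x
              N₂ , h₂ = p≤1 δ 0<δ
              N₃ , h₃ = p≤1 1ℚ (ℚ.positive⁻¹ 1ℚ)
          in N₁ ℕ.⊔ (N₂ ℕ.⊔ N₃) , λ j N≤j →
            let N₂₃≤j = ℕ.m⊔n≤o⇒n≤o N₁ (N₂ ℕ.⊔ N₃) N≤j
            in Prob-expands 3d≤n c≤n (ℚ.<⇒≤ 0<η) 1≤2ⁿη (ℚ.<⇒≤ 0<δ) 4ᵉδ≤η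
                 (2x-x≤q (h₁ j (ℕ.m⊔n≤o⇒m≤o N₁ (N₂ ℕ.⊔ N₃) N≤j)))
                 (h₂ j (ℕ.m⊔n≤o⇒m≤o N₂ N₃ N₂₃≤j))
                 (h₃ j (ℕ.m⊔n≤o⇒n≤o N₂ N₃ N₂₃≤j))
          where
          W : ℕ
          W = 4 ℕ.^ length (pairs n)
          instance
            W≢0 : ℕ.NonZero W
            W≢0 = ℕ.m^n≢0 4 (length (pairs n))
          δ : ℚ
          δ = (+ 1 ℚ./ W) ℚ.* η
          0<δ : 0ℚ ℚ.< δ
          0<δ = 0<* (0<1/ W) 0<η
          4ᵉδ≤η : ι W ℚ.* δ ℚ.≤ η
          4ᵉδ≤η = ℚ.≤-reflexive (trans (sym (ℚ.*-assoc (ι W) (+ 1 ℚ./ W) η))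
            (trans (cong (ℚ._* η) (ι-inverse W)) (ℚ.*-identityˡ η)))

    threshold : ∃[ C ] 0ℝ < C × (∀ (p : ℕ → ℝ) → Admissible C p →
      WithHighProbability p (λ n G → DoNotSuffice (E n G) (α * fromℕ n)))
    threshold = fromℚ (ι (c ℕ.+ c)) , (1ℚ , ℚ.positive⁻¹ 1ℚ , 0 , λ _ _ → 1≤C) , whp
      where
      1≤C : 0ℚ ℚ.+ 1ℚ ℚ.≤ ι (c ℕ.+ c)
      1≤C = ι-mono-≤ {1} (ℕ.≤-trans 0<c (ℕ.m≤m+n c c))

      whp : ∀ (p : ℕ → ℝ) → Admissible (fromℚ (ι (c ℕ.+ c))) p →
        WithHighProbability p (λ n G → DoNotSuffice (E n G) (α * fromℕ n))
      whp p (n₀ , admissible) ε (ε₀ , 0<ε₀ , Nε , hε) = N , λ n N≤n →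
        let n₀≤n = ℕ.m⊔n≤o⇒m≤o n₀ N₃ N≤n
            N′≤n = ℕ.m⊔n≤o⇒n≤o n₀ N₃ N≤n
            3d≤n = ℕ.m⊔n≤o⇒m≤o (3 ℕ.* d) (c ℕ.⊔ b) N′≤n
            N″≤n = ℕ.m⊔n≤o⇒n≤o (3 ℕ.* d) (c ℕ.⊔ b) N′≤n
            c≤n  = ℕ.m⊔n≤o⇒m≤o c b N″≤n
            b≤n  = ℕ.m⊔n≤o⇒n≤o c b N″≤n
            instance n≢0 = ℕ.>-nonZero (ℕ.≤-trans (s≤s z≤n) 3d≤n)
            C/n≤p , p≤1 = admissible n n₀≤n
            Nη , hη = eventually n (p n) η 0<η 3d≤n c≤n (1≤2ⁿη n b≤n) C/n≤p p≤1
            B = hitsAll (masks n (size n ℕ.* size n))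
        in B , (λ G → doNotSuffice n G 3d≤n) , η , 0<η , Nε ℕ.⊔ Nη , λ j N≤j →
           subst (λ y → (1ℚ ℚ.- seq ε j) ℚ.+ η ℚ.≤ y) (sym (seq-Pr (p n) j B))
             (gap′ (hε j (ℕ.m⊔n≤o⇒m≤o Nε Nη N≤j)) (hη j (ℕ.m⊔n≤o⇒n≤o Nε Nη N≤j)))
        where
        η : ℚ
        -- Two thirds of `ε₀` cover the failure probability; the last third is the positive gap that
        -- `<` on reals demands.
        η = (+ 1 ℚ./ 3) ℚ.* ε₀
        0<η : 0ℚ ℚ.< η
        0<η = 0<* (ℚ.positive⁻¹ (+ 1 ℚ./ 3)) 0<ε₀
        b N₃ N : ℕ
        b = suc (proj₁ (archimedean η 0<η))
        -- n ≥ 3d makes `size n` positive, n ≥ c gives c/n ≤ 1, and n ≥ b gives 2^n `η` ≥ 1.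
        N₃ = 3 ℕ.* d ℕ.⊔ (c ℕ.⊔ b)
        N = n₀ ℕ.⊔ N₃
        1≤2ⁿη : ∀ n → b ℕ.≤ n → 1ℚ ℚ.≤ ι (2 ℕ.^ n) ℚ.* η
        1≤2ⁿη n b≤n = ℚ.≤-trans (proj₂ (archimedean η 0<η))
          (*-monoʳ (ℚ.<⇒≤ 0<η) (ι-mono-≤ (ℕ.≤-trans b≤n (n≤2^n n))))
        gap′ : ∀ {e P} → 0ℚ ℚ.+ ε₀ ℚ.≤ e → 1ℚ ℚ.≤ P ℚ.+ (η ℚ.+ η) → (1ℚ ℚ.- e) ℚ.+ η ℚ.≤ P
        gap′ {e} {P} ε₀≤e 1≤P+2η = begin
          (1ℚ ℚ.- e) ℚ.+ η
            ≤⟨ ℚ.+-monoˡ-≤ η (ℚ.+-mono-≤ 1≤P+2η (ℚ.neg-antimono-≤ ε₀≤e)) ⟩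
          ((P ℚ.+ (η ℚ.+ η)) ℚ.- (0ℚ ℚ.+ ε₀)) ℚ.+ η
            ≡⟨ solve 2 (λ P ε →
                 ((P :+ (con (+ 1 ℚ./ 3) :* ε :+ con (+ 1 ℚ./ 3) :* ε)) :- (con 0ℚ :+ ε)) :+
                 con (+ 1 ℚ./ 3) :* ε := P) refl P ε₀ ⟩
          P ∎
          where
          open ℚ.≤-Reasoning
          open ℚ-Solver

  threshold : ∀ α → 0ℝ < α → α < 1ℝ →
    ∃[ C ] 0ℝ < C × (∀ (p : ℕ → ℝ) → Admissible C p →
      WithHighProbability p (λ n G → DoNotSuffice (E n G) (α * fromℕ n)))
  threshold α _ (δ , 0<δ , N , α+δ≤1) =
    -- The gap `δ` witnessing α < 1 is halved into the two `ε` that `room` spends.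
    let d-1 , 1≤dε = archimedean (½ ℚ.* δ) 0<½δ
    in Threshold.threshold α 0<½δ N
         (λ j N≤j → subst (λ x → seq α j ℚ.+ x ℚ.≤ 1ℚ) (sym halves) (α+δ≤1 j N≤j)) d-1 1≤dε
    where
    0<½δ : 0ℚ ℚ.< ½ ℚ.* δ
    0<½δ = 0<* (ℚ.positive⁻¹ ½) 0<δ
    halves : ½ ℚ.* δ ℚ.+ ½ ℚ.* δ ≡ δ
    halves = trans (sym (ℚ.*-distribʳ-+ δ ½ ½)) (ℚ.*-identityˡ δ)

-- The undirected and the directed model.

Adj? : ∀ n G → Decidable (Adj n G)
Adj? n G u v = Fin.any? λ e → e ∈? G ×-dec
  (≡-dec Fin._≟_ Fin._≟_ (List.lookup (unorderedPairs n) e) (u , v) ⊎-dec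
   ≡-dec Fin._≟_ Fin._≟_ (List.lookup (unorderedPairs n) e) (v , u))

Arc? : ∀ n G → Decidable (Arc n G)
Arc? n G u v = Fin.any? λ e → e ∈? G ×-dec
  ≡-dec Fin._≟_ Fin._≟_ (List.lookup (orderedPairs n) e) (u , v)

crossing⇒Adj : ∀ {n G e} (A B : Subset n) → e ∈ G →
  crossing A B (List.lookup (unorderedPairs n) e) ≡ true → ∃₂ λ u v → u ∈ A × v ∈ B × Adj n G u v
crossing⇒Adj A B e∈G eq with crossing⁻ A B eq
... | inj₁ (u∈A , v∈B) = _ , _ , u∈A , v∈B , _ , e∈G , inj₁ refl
-- The edge is listed from `B` to `A`, so its ends are exchanged and the second alternative of `Adj`
-- applies.
... | inj₂ (v∈A , u∈B) = _ , _ , v∈A , u∈B , _ , e∈G , inj₂ refl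

forward⇒Arc : ∀ {n G e} (A B : Subset n) → e ∈ G →
  forward A B (List.lookup (orderedPairs n) e) ≡ true → ∃₂ λ u v → u ∈ A × v ∈ B × Arc n G u v
forward⇒Arc A B e∈G eq with u∈A , v∈B ← forward⁻ A B eq =
  _ , _ , u∈A , v∈B , _ , e∈G , refl

module UndirectedGraph =
  RandomGraph unorderedPairs Adj Adj? crossing ∣crossing∣ crossing⇒Adj

module DirectedGraph =
  RandomGraph orderedPairs Arc Arc? forward ∣forward∣ forward⇒Arc

theorem1 : (∀ (α : ℝ) → 0ℝ < α → α < 1ℝ →
    ∃[ C ] 0ℝ < C × (∀ (p : ℕ → ℝ) → Admissible C p →
    WithHighProbability p (λ n (G : Graph n) → DoNotSuffice (Adj n G) (α * fromℕ n))))
    ×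
    (∀ (α : ℝ) → 0ℝ < α → α < 1ℝ →
    ∃[ C ] 0ℝ < C × (∀ (p : ℕ → ℝ) → Admissible C p →
    WithHighProbability p (λ n (G : Digraph n) → DoNotSuffice (Arc n G) (α * fromℕ n))))
theorem1 = UndirectedGraph.threshold , DirectedGraph.threshold
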